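{- Let $p$ be an odd prime, let $m\ge 2$ be an integer, let $q=p^m$, and let $0<i<m$ be an integer. If $\gcd(i,m)=\gcd(i,2m)$, then the polynomial $$F(x)=x^2 + x^{q+1} - x^{(q+1)p^i} + x^{2qp^i}\in\mathbb{F}_{q^2}[x]$$ is a planar Dembowski–Ostrom (DO) polynomial over $\mathbb{F}_{q^2}$ representing the Dickson semifield with parameter $i$; that is, the commutative presemifield $(\mathbb{F}_{q^2},+,\star_F)$ with $x\star_F y=F(x+y)-F(x)-F(y)$ is isotopic to the Dickson commutative semifield $(\mathbb{F}_{p^m}^2,+,\star)$ given by $(a,b)\star(c,d)=(ac+\alpha (bd)^{p^i},\,ad+bc)$ for all $a,b,c,d\in\mathbb{F}_{p^m}$, where $\alpha\in\mathbb{F}_{p^m}$ is a nonsquare.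
   Context: A function $F:\mathbb{F}_{p^n}\to\mathbb{F}_{p^n}$ ($p$ odd) is planar if for every $a\in\mathbb{F}_{p^n}\setminus\{0\}$ the map $x\mapsto F(x+a)-F(x)$ is a bijection of $\mathbb{F}_{p^n}$. A DO polynomial over $\mathbb{F}_{p^n}$ is a polynomial of the form $\sum_{0\le k\le j<n}\alpha_{k,j}x^{p^j+p^k}$ with $\alpha_{k,j}\in\mathbb{F}_{p^n}$ (every monomial has algebraic degree exactly 2). A presemifield is a set with two binary operations $+,\star$ such that $(S,+)$ is an abelian group, $\star$ is left and right distributive over $+$, and $a\star b=0$ implies $a=0$ or $b=0$. Two presemifields $(\mathbb{F}_{q'},+,\star)$ and $(\mathbb{F}_{q'},+,*)$ (identified via additive isomorphism) are isotopic if there are linear ($\mathbb{F}_p$-linear) permutations $L,M,N$ with $L(x\star y)=M(x)*N(y)$ for all $x,y$. For a planar DO polynomial $F$, $x\star_F y=F(x+y)-F(x)-F(y)$ defines a commutative presemifield. For fixed $i$, all nonsquares $\alpha$ give isotopic Dickson semifields. -}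

module Defs where

open import Data.Nat as ℕ using (ℕ; zero; suc)
open import Data.List using (List; length)
open import Data.List.Relation.Unary.Unique.Propositional using (Unique)
open import Data.List.Membership.Propositional using (_∈_)
open import Data.Product using (Σ; ∃; _×_; _,_)
open import Relation.Binary.PropositionalEquality using (_≡_)
open import Relation.Nullary using (¬_)
open import Algebra.Structures using (IsCommutativeRing)
open import Function.Definitions using (Bijective)

record FiniteField : Set₁ where
  infixl 6 _+_
  infixl 7 _*_
  field
    Carrier : Set
    _+_ _*_ : Carrier → Carrier → Carrier
    -_      : Carrier → Carrier
    0# 1#   : Carrier
    isCommutativeRing : IsCommutativeRing _≡_ _+_ _*_ -_ 0# 1#
    0≢1     : ¬ (0# ≡ 1#)
    inverse : ∀ x → ¬ (x ≡ 0#) → Σ Carrier (λ y → x * y ≡ 1#)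
    elements : List Carrier
    elements-unique : Unique elements
    elements-complete : ∀ x → x ∈ elements

  order : ℕ
  order = length elements

  _-_ : Carrier → Carrier → Carrier
  x - y = x + (- y)

  _^_ : Carrier → ℕ → Carrier
  x ^ zero  = 1#
  x ^ suc n = x * (x ^ n)

  sumTo : ℕ → (ℕ → Carrier) → Carrier
  sumTo zero    f = 0#
  sumTo (suc n) f = sumTo n f + f n

  IsSquare : Carrier → Set
  IsSquare a = ∃ λ y → y * y ≡ a

  -- additive (equivalently F_p-linear, the characteristic being p) maps
  Additive : (Carrier → Carrier) → Set
  Additive f = ∀ x y → f (x + y) ≡ f x + f y

open FiniteField

Planar : (K : FiniteField) → (Carrier K → Carrier K) → Set
Planar K F = ∀ a → ¬ (a ≡ 0# K) →
  Bijective _≡_ _≡_ (λ x → _-_ K (F (_+_ K x a)) (F x))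

IsDO : (p n : ℕ) (K : FiniteField) → (Carrier K → Carrier K) → Set
IsDO p n K F = ∃ λ (α : ℕ → ℕ → Carrier K) → ∀ x →
  F x ≡ sumTo K n (λ j → sumTo K (suc j) (λ k →
          _*_ K (α k j) (_^_ K x ((p ℕ.^ j) ℕ.+ (p ℕ.^ k)))))

starF : (K : FiniteField) → (Carrier K → Carrier K) →
        Carrier K → Carrier K → Carrier K
starF K F x y = _-_ K (_-_ K (F (_+_ K x y)) (F x)) (F y)

dickson : (E : FiniteField) (p i : ℕ) (α : Carrier E) →
          Carrier E × Carrier E → Carrier E × Carrier E → Carrier E × Carrier E
dickson E p i α (a , b) (c , d) =
  ( _+_ E (_*_ E a c) (_*_ E α (_^_ E (_*_ E b d) (p ℕ.^ i)))
  , _+_ E (_*_ E a d) (_*_ E b c) )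

_⊕_ : {E : FiniteField} → Carrier E × Carrier E → Carrier E × Carrier E →
      Carrier E × Carrier E
_⊕_ {E} (a , b) (c , d) = (_+_ E a c , _+_ E b d)

AdditiveIso : (K E : FiniteField) → (Carrier K → Carrier E × Carrier E) → Set
AdditiveIso K E f =
  (∀ x y → f (_+_ K x y) ≡ _⊕_ {E} (f x) (f y)) × Bijective _≡_ _≡_ f

Isotopic : (K E : FiniteField) →
           (Carrier K → Carrier K → Carrier K) →
           (Carrier E × Carrier E → Carrier E × Carrier E → Carrier E × Carrier E) → Set
Isotopic K E star mul =
  ∃ λ L → ∃ λ M → ∃ λ N →
    AdditiveIso K E L × AdditiveIso K E M × AdditiveIso K E N ×
    (∀ x y → L (star x y) ≡ mul (M x) (N y))

polyF : (p m i : ℕ) (K : FiniteField) → Carrier K → Carrier K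
polyF p m i K x =
  _+_ K (_-_ K (_+_ K (_^_ K x 2) (_^_ K x (q ℕ.+ 1)))
               (_^_ K x ((q ℕ.+ 1) ℕ.* (p ℕ.^ i))))
        (_^_ K x (2 ℕ.* q ℕ.* (p ℕ.^ i)))
  where q = p ℕ.^ m

{-# OPTIONS --safe #-}

-- Write x̄ = x^q and σ(x) = x^(p^i), and call x even if x̄ = x and odd if x̄ = −x.  Splitting
-- x = u + v and y = w + z into even and odd parts gives
--     x ⋆ y = 4 (u w + σ(v z)) + 2 (s − σ(s)),   s = u z + v w,
-- and s ↦ s − σ(s) is injective on odd elements: σ(s) = s and s^(p^2m) = s force s to be fixed by
-- the gcd(i,2m)-th power of the Frobenius map, hence by x ↦ x̄ since gcd(i,2m) divides m.  So
-- x ⋆ y = 0 splits into u w + σ(v z) = 0 and s = 0, which for y ≠ 0 has only the zero solution.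
-- Given a field embedding φ : E → K and an odd ω with σ(ω²) = φ(α), putting u = φ(a), v = φ(b) ω,
-- w = φ(c), z = φ(d) ω in the formula gives (a , b) ⋆ (c , d) in the Dickson semifield.  Such an ω
-- is η^(p^(m−i)) with η² = φ(α); Euler's criterion provides η in K, and makes it odd because α is a
-- nonsquare in E.
--
-- The embedding E → K needs no minimal polynomials.  A polynomial over ℕ in |E| variables that
-- vanishes on K vanishes on E, because it can be reduced to degree < |K| in each variable.  If no
-- point of K^E satisfied the equations of a homomorphism, the indicator polynomial of these
-- equations would vanish on K, but it is 1 at the tautological point of E^E.
module Submission where

open import Defs
open import Algebra.Bundles using (CommutativeRing; RawRing)
import Algebra.Properties.AbelianGroup as AbelianGroupProperties
import Algebra.Properties.CommutativeSemiring.Binomial as Binomial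
import Algebra.Properties.CommutativeSemiring.Exp as Exp
import Algebra.Properties.Monoid.Sum as MonoidSum
import Algebra.Properties.Ring as RingProperties
import Algebra.Properties.Semiring.Mult as Mult
import Algebra.Properties.Semiring.Mult.TCOptimised as Mult′
import Algebra.Solver.Ring as RingSolver
open import Algebra.Solver.Ring.AlmostCommutativeRing using (fromCommutativeRing; _-Raw-AlmostCommutative⟶_)
open import Data.Empty using (⊥; ⊥-elim)
open import Data.Fin.Base as Fin using (Fin; zero; suc; toℕ; fromℕ; inject₁; punchOut; combine; remQuot)
import Data.Fin.Properties as Fin
open import Data.Integer.Base as ℤ using (ℤ; -[1+_]) renaming (+_ to pos)
import Data.Integer.Properties as ℤ
open import Data.List.Base using (List; []; _∷_; length; lookup; map; filter; foldr)
open import Data.List.Membership.Propositional using (_∈_)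
open import Data.List.Membership.Propositional.Properties using (∈-map⁺; ∈-map⁻; ∈-filter⁺; ∈-filter⁻; ∈-lookup)
open import Data.List.Membership.Propositional.Properties.WithK using (unique∧set⇒bag)
open import Data.List.Relation.Binary.BagAndSetEquality using (∼bag⇒↭)
open import Data.List.Relation.Binary.Permutation.Propositional using (_↭_; ↭⇒↭ₛ)
open import Data.List.Relation.Binary.Permutation.Propositional.Properties using (↭-length)
import Data.List.Relation.Binary.Permutation.Setoid.Properties as PermSetoid
open import Data.List.Relation.Unary.All as All using (All; []; _∷_)
open import Data.List.Relation.Unary.AllPairs using ([]; _∷_)
open import Data.List.Relation.Unary.Any as Any using (here; there)
open import Data.List.Relation.Unary.Any.Properties using (lookup-index)
open import Data.List.Relation.Unary.Unique.Propositional using (Unique)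
import Data.List.Relation.Unary.Unique.Propositional.Properties as Unique
open import Data.Maybe.Base using (Maybe; just; nothing)
open import Data.Nat.Base as ℕ using (ℕ; zero; suc; s≤s; _!)
open import Data.Nat.Combinatorics using (_C_; nCn≡1; nCk≡n!/k![n-k]!; k![n∸k]!∣n!)
open import Data.Nat.Coprimality using (Coprime; coprime-Bézout)
open import Data.Nat.Divisibility using (_∣_; _∣?_; divides; ∣⇒≤; m∣m*n; m%n≡0⇒n∣m)
open import Data.Nat.DivMod using (_%_; _/_; m≡m%n+[m/n]*n; m%n<n; m/n*n≡m)
open import Data.Nat.GCD using (gcd; gcd[m,n]∣n; gcd-GCD; module Bézout)
open import Data.Nat.Primality using (Prime; euclidsLemma; prime⇒irreducible; prime⇒nonZero; prime⇒nonTrivial)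
import Data.Nat.Properties as ℕ
import Data.Nat.Solver as ℕSolver
open import Data.Product.Base using (∃; _,_; proj₁; proj₂) renaming (_×_ to _∧_)
open import Data.Sum.Base as Sum using (_⊎_; inj₁; inj₂)
open import Data.Vec.Base as Vec using (Vec; []; _∷_; zipWith; replicate; tabulate)
import Data.Vec.Properties as Vec
open import Function.Base using (_∘_)
open import Function.Bundles using (mk⇔)
open import Function.Definitions using (Injective; Bijective)
open import Level using (0ℓ)
open import Relation.Binary.Definitions using (DecidableEquality)
open import Relation.Binary.PropositionalEquality
open import Relation.Nullary using (¬_; yes; no; contradiction; ¬?)
open import Relation.Nullary.Decidable using (map′; toSum; decidable-stable)

-- Finite counting, binomial coefficients and parity

Fin-injective⇒surjective : ∀ {n} (f : Fin n → Fin n) → Injective _≡_ _≡_ f → ∀ y → ∃ λ x → f x ≡ y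
Fin-injective⇒surjective {suc n} f inj y with Fin.any? (λ x → f x Fin.≟ y)
... | yes hit = hit
-- Were y missed, punching it out of the codomain would leave an injection of a set of n + 1
-- elements into one of n.
... | no miss = contradiction (Fin.injective⇒≤ g-injective) ℕ.1+n≰n
  where
  y≢f : ∀ x → ¬ (y ≡ f x)
  y≢f x eq = miss (x , sym eq)
  g-injective : Injective _≡_ _≡_ (λ x → punchOut (y≢f x))
  g-injective = inj ∘ Fin.punchOut-injective (y≢f _) (y≢f _)

-- Injections in both directions are what the pigeonhole argument of `injective⇒bijective` uses. The
-- first one also supplies decidable equality, which a `FiniteField` does not carry.
record Enumerated (A : Set) (n : ℕ) : Set where
  field
    index           : A → Fin n
    index-injective : Injective _≡_ _≡_ index
    enum            : Fin n → A
    enum-injective  : Injective _≡_ _≡_ enum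

  infix 4 _≟_
  _≟_ : DecidableEquality A
  x ≟ y = map′ index-injective (cong index) (index x Fin.≟ index y)

Enumerated-× : ∀ {A B m n} → Enumerated A m → Enumerated B n → Enumerated (A ∧ B) (m ℕ.* n)
Enumerated-× {m = m} {n} eA eB = record
  { index           = λ (a , b) → combine (A.index a) (B.index b)
  ; index-injective = λ {(a , b)} {(a′ , b′)} eq → let p , q = Fin.combine-injective (A.index a) (B.index b) (A.index a′) (B.index b′) eq in
                      cong₂ _,_ (A.index-injective p) (B.index-injective q)
  ; enum            = λ k → A.enum (proj₁ (remQuot n k)) , B.enum (proj₂ (remQuot {m} n k))
  ; enum-injective  = λ {k} {l} eq → trans (sym (Fin.combine-remQuot {m} n k))
                        (trans (cong₂ combine (A.enum-injective (cong proj₁ eq)) (B.enum-injective (cong proj₂ eq)))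
                               (Fin.combine-remQuot {m} n l))
  }
  where
  module A = Enumerated eA
  module B = Enumerated eB

-- Conjugating by the enumerations turns f into an injective self-map of `Fin n`.
injective⇒bijective : ∀ {A B n} → Enumerated A n → Enumerated B n →
                      (f : A → B) → Injective _≡_ _≡_ f → Bijective _≡_ _≡_ f
injective⇒bijective eA eB f inj = inj , λ y →
  let j , eq = Fin-injective⇒surjective (B.index ∘ f ∘ A.enum) (A.enum-injective ∘ inj ∘ B.index-injective) (B.index y)
  in A.enum j , λ { refl → B.index-injective eq }
  where
  module A = Enumerated eA
  module B = Enumerated eB

Unique-lookup-injective : ∀ {A : Set} {xs : List A} → Unique xs → Injective _≡_ _≡_ (lookup xs)
Unique-lookup-injective (_ ∷ _)  {zero}  {zero}  _  = refl
Unique-lookup-injective (x∉ ∷ _) {zero}  {suc j} eq = contradiction eq (All.lookup x∉ (∈-lookup j))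
Unique-lookup-injective (x∉ ∷ _) {suc i} {zero}  eq = contradiction (sym eq) (All.lookup x∉ (∈-lookup i))
Unique-lookup-injective (_ ∷ u)  {suc i} {suc j} eq = cong suc (Unique-lookup-injective u eq)

-- In a list without repetitions an element occurs in at most one way, so having the same elements
-- is already equality as bags.
Unique-↭ : ∀ {A : Set} {xs ys : List A} → Unique xs → Unique ys →
           (∀ {x} → x ∈ xs → x ∈ ys) → (∀ {x} → x ∈ ys → x ∈ xs) → xs ↭ ys
Unique-↭ u v f g = ∼bag⇒↭ (unique∧set⇒bag u v (mk⇔ f g))

p∤k! : ∀ {p} → Prime p → ∀ {k} → k ℕ.< p → ¬ (p ∣ k !)
p∤k! pr {zero}  k<p p∣1 = ℕ.<-irrefl refl (ℕ.<-≤-trans (ℕ.nonTrivial⇒n>1 _ {{prime⇒nonTrivial pr}}) (∣⇒≤ p∣1))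
p∤k! pr {suc k} k<p p∣  with euclidsLemma (suc k) (k !) pr p∣
... | inj₁ p∣k+1 = ℕ.<-irrefl refl (ℕ.<-≤-trans k<p (∣⇒≤ p∣k+1))
... | inj₂ p∣k!  = p∤k! pr (ℕ.<-trans (ℕ.n<1+n k) k<p) p∣k!

-- Here p divides p! = (p C k) k! (p - k)!, but neither of the two factorials, whose arguments are
-- below p.
p∣pCk : ∀ {p k} → Prime p → 0 ℕ.< k → k ℕ.< p → p ∣ p C k
p∣pCk {suc p} {k} pr 0<k k<p with euclidsLemma (suc p C k) (k ! ℕ.* (suc p ℕ.∸ k) !) pr p∣product
  where
  k≤p = ℕ.<⇒≤ k<p
  product≡p! : (suc p C k) ℕ.* (k ! ℕ.* (suc p ℕ.∸ k) !) ≡ suc p !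
  product≡p! = trans (cong (ℕ._* (k ! ℕ.* (suc p ℕ.∸ k) !)) (nCk≡n!/k![n-k]! k≤p))
                     (m/n*n≡m {{k ℕ.!* (suc p ℕ.∸ k) !≢0}} (k![n∸k]!∣n! k≤p))
  p∣product : suc p ∣ (suc p C k) ℕ.* (k ! ℕ.* (suc p ℕ.∸ k) !)
  p∣product = subst (suc p ∣_) (sym product≡p!) (m∣m*n (p !))
... | inj₁ p∣C = p∣C
... | inj₂ p∣k![p-k]! with euclidsLemma (k !) ((suc p ℕ.∸ k) !) pr p∣k![p-k]!
...   | inj₁ p∣k!     = contradiction p∣k! (p∤k! pr k<p)
...   | inj₂ p∣[p-k]! = contradiction p∣[p-k]! (p∤k! pr (ℕ.∸-monoʳ-< 0<k (ℕ.<⇒≤ k<p)))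

odd : ∀ {n} → ¬ (2 ∣ n) → ∃ λ h → n ≡ suc (h ℕ.* 2)
odd {n} 2∤n with n % 2 in n%2≡ | m%n<n n 2 | m≡m%n+[m/n]*n n 2
... | 0           | _             | _  = contradiction (m%n≡0⇒n∣m n 2 n%2≡) 2∤n
... | 1           | _             | eq = n / 2 , eq
... | suc (suc _) | s≤s (s≤s ()) | _

odd-^ : ∀ {n} → (∃ λ h → n ≡ suc (h ℕ.* 2)) → ∀ k → ∃ λ h → n ℕ.^ k ≡ suc (h ℕ.* 2)
odd-^ n-odd zero    = 0 , refl
odd-^ (a , refl) (suc k) with odd-^ (a , refl) k
-- From (2a + 1)(2b + 1) = 2(b + a(2b + 1)) + 1.
... | b , eq = b ℕ.+ a ℕ.* suc (b ℕ.* 2) , trans (cong (suc (a ℕ.* 2) ℕ.*_) eq)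
  (solve 2 (λ a b → (con 1 :+ a :* con 2) :* (con 1 :+ b :* con 2) :=
                    con 1 :+ (b :+ a :* (con 1 :+ b :* con 2)) :* con 2) refl a b)
  where open ℕSolver.+-*-Solver

-- Arithmetic of finite fields

module RingStructure (K : FiniteField) where
  open FiniteField K public hiding (_-_)

  commutativeRing : CommutativeRing 0ℓ 0ℓ
  commutativeRing = record { isCommutativeRing = isCommutativeRing }

  open CommutativeRing commutativeRing public
    using (+-assoc; +-comm; +-identityˡ; +-identityʳ; -‿inverseˡ; -‿inverseʳ
          ; *-assoc; *-comm; *-identityˡ; *-identityʳ; distribˡ; distribʳ; zeroˡ; zeroʳ
          ; ring; semiring; commutativeSemiring; +-abelianGroup)
  open RingProperties ring public using (-‿distribˡ-*; -‿distribʳ-*; -‿involutive; -0#≈0#)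
  open AbelianGroupProperties +-abelianGroup public using (⁻¹-∙-comm)
  open Mult semiring public using (_×_; ×1-homo-*; ×-homo-+)
  private module M′ = Mult′ semiring

  private
    -- The optimised multiple makes `pos 1` evaluate to `1#` by computation, so that `con (pos 1)`
    -- in a solver equation matches a literal `1#`.
    _·1 : ℕ → Carrier
    n ·1 = n M′.× 1#

    ⟦_⟧ : ℤ → Carrier
    ⟦ pos n ⟧     = n ·1
    ⟦ -[1+ n ] ⟧ = - (suc n ·1)

    suc-·1 : ∀ n → suc n ·1 ≡ 1# + n ·1
    suc-·1 n = M′.×-homo-+ 1# 1 n

    ⟦-⟧ : ∀ a → ⟦ ℤ.- a ⟧ ≡ - ⟦ a ⟧
    ⟦-⟧ (pos zero)    = sym -0#≈0#
    ⟦-⟧ (pos (suc n))   = refl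
    ⟦-⟧ (-[1+ n ]) = sym (-‿involutive _)

    ⟦⊖⟧ : ∀ m n → ⟦ m ℤ.⊖ n ⟧ ≡ m ·1 + - (n ·1)
    ⟦⊖⟧ zero zero = sym (-‿inverseʳ 0#)
    ⟦⊖⟧ zero (suc n) = sym (+-identityˡ _)
    ⟦⊖⟧ (suc m) zero = sym (trans (cong (suc m ·1 +_) -0#≈0#) (+-identityʳ _))
    ⟦⊖⟧ (suc m) (suc n) = begin
      ⟦ suc m ℤ.⊖ suc n ⟧                   ≡⟨ cong ⟦_⟧ (ℤ.[1+m]⊖[1+n]≡m⊖n m n) ⟩
      ⟦ m ℤ.⊖ n ⟧                           ≡⟨ ⟦⊖⟧ m n ⟩
      m ·1 + - (n ·1)                       ≡⟨ cong (_+ - (n ·1)) (sym (+-identityʳ _)) ⟩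
      m ·1 + 0# + - (n ·1)                  ≡⟨ cong (λ z → m ·1 + z + - (n ·1)) (sym (-‿inverseʳ 1#)) ⟩
      m ·1 + (1# + - 1#) + - (n ·1)         ≡⟨ cong (_+ - (n ·1)) (sym (+-assoc _ _ _)) ⟩
      m ·1 + 1# + - 1# + - (n ·1)           ≡⟨ cong (λ z → z + - 1# + - (n ·1)) (+-comm _ _) ⟩
      1# + m ·1 + - 1# + - (n ·1)           ≡⟨ +-assoc _ _ _ ⟩
      1# + m ·1 + (- 1# + - (n ·1))         ≡⟨ cong (1# + m ·1 +_) (⁻¹-∙-comm _ _) ⟩
      1# + m ·1 + - (1# + n ·1)             ≡⟨ cong₂ (λ a b → a + - b) (suc-·1 m) (suc-·1 n) ⟨
      suc m ·1 + - (suc n ·1)               ∎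
      where open ≡-Reasoning

    ⟦+⟧ : ∀ a b → ⟦ a ℤ.+ b ⟧ ≡ ⟦ a ⟧ + ⟦ b ⟧
    ⟦+⟧ (pos m)      (pos n)      = M′.×-homo-+ 1# m n
    ⟦+⟧ (pos m)      (-[1+ n ]) = ⟦⊖⟧ m (suc n)
    ⟦+⟧ (-[1+ m ]) (pos n)      = trans (⟦⊖⟧ n (suc m)) (+-comm _ _)
    ⟦+⟧ (-[1+ m ]) (-[1+ n ]) = trans (cong -_ lemma) (sym (⁻¹-∙-comm _ _))
      where
      lemma : suc (suc (m ℕ.+ n)) ·1 ≡ suc m ·1 + suc n ·1
      lemma = begin
        suc (suc (m ℕ.+ n)) ·1   ≡⟨ suc-·1 (suc m ℕ.+ n) ⟩
        1# + (suc m ℕ.+ n) ·1    ≡⟨ cong (1# +_) (M′.×-homo-+ 1# (suc m) n) ⟩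
        1# + (suc m ·1 + n ·1)   ≡⟨ sym (+-assoc _ _ _) ⟩
        1# + suc m ·1 + n ·1     ≡⟨ cong (_+ n ·1) (+-comm _ _) ⟩
        suc m ·1 + 1# + n ·1     ≡⟨ +-assoc _ _ _ ⟩
        suc m ·1 + (1# + n ·1)   ≡⟨ cong (suc m ·1 +_) (suc-·1 n) ⟨
        suc m ·1 + suc n ·1      ∎
        where open ≡-Reasoning

    ⟦*⟧⁺ : ∀ m b → ⟦ pos m ℤ.* b ⟧ ≡ m ·1 * ⟦ b ⟧
    ⟦*⟧⁺ m (pos n) = trans (cong ⟦_⟧ (sym (ℤ.pos-* m n))) (M′.×1-homo-* m n)
    ⟦*⟧⁺ m (-[1+ n ]) = begin
      ⟦ pos m ℤ.* -[1+ n ] ⟧         ≡⟨ cong ⟦_⟧ (sym (ℤ.neg-distribʳ-* (pos m) (pos (suc n)))) ⟩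
      ⟦ ℤ.- (pos m ℤ.* pos (suc n)) ⟧    ≡⟨ ⟦-⟧ (pos m ℤ.* pos (suc n)) ⟩
      - ⟦ pos m ℤ.* pos (suc n) ⟧        ≡⟨ cong -_ (⟦*⟧⁺ m (pos (suc n))) ⟩
      - (m ·1 * suc n ·1)          ≡⟨ -‿distribʳ-* _ _ ⟩
      m ·1 * - (suc n ·1)          ∎
      where open ≡-Reasoning

    ⟦*⟧ : ∀ a b → ⟦ a ℤ.* b ⟧ ≡ ⟦ a ⟧ * ⟦ b ⟧
    ⟦*⟧ (pos m)      b = ⟦*⟧⁺ m b
    ⟦*⟧ (-[1+ m ]) b = begin
      ⟦ -[1+ m ] ℤ.* b ⟧           ≡⟨ cong ⟦_⟧ (sym (ℤ.neg-distribˡ-* (pos (suc m)) b)) ⟩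
      ⟦ ℤ.- (pos (suc m) ℤ.* b) ⟧      ≡⟨ ⟦-⟧ (pos (suc m) ℤ.* b) ⟩
      - ⟦ pos (suc m) ℤ.* b ⟧          ≡⟨ cong -_ (⟦*⟧⁺ (suc m) b) ⟩
      - (suc m ·1 * ⟦ b ⟧)         ≡⟨ -‿distribˡ-* _ _ ⟩
      - (suc m ·1) * ⟦ b ⟧         ∎
      where open ≡-Reasoning

    ℤ-rawRing : RawRing 0ℓ 0ℓ
    ℤ-rawRing = record { _≈_ = _≡_ ; _+_ = ℤ._+_ ; _*_ = ℤ._*_ ; -_ = ℤ.-_ ; 0# = ℤ.0ℤ ; 1# = ℤ.1ℤ }

    ℤ⟶K : ℤ-rawRing -Raw-AlmostCommutative⟶ fromCommutativeRing commutativeRing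
    ℤ⟶K = record { ⟦_⟧ = ⟦_⟧ ; +-homo = ⟦+⟧ ; *-homo = ⟦*⟧ ; -‿homo = ⟦-⟧ ; 0-homo = refl ; 1-homo = refl }

    _≟ℤ_ : ∀ a b → Maybe (⟦ a ⟧ ≡ ⟦ b ⟧)
    a ≟ℤ b with a ℤ.≟ b
    ... | yes a≡b = just (cong ⟦_⟧ a≡b)
    ... | no  _   = nothing

  module Solver = RingSolver ℤ-rawRing (fromCommutativeRing commutativeRing) ℤ⟶K _≟ℤ_
  open Solver public using (solve; con; _:=_; _:+_; _:*_; :-_; _:-_)

module FieldTheory (K : FiniteField) where
  open RingStructure K public

  enumerated : Enumerated Carrier order
  enumerated = record
    { index           = λ x → Any.index (elements-complete x)
    ; index-injective = λ {x} {y} eq → trans (lookup-index (elements-complete x))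
                          (trans (cong (lookup elements) eq) (sym (lookup-index (elements-complete y))))
    ; enum            = lookup elements
    ; enum-injective  = Unique-lookup-injective elements-unique
    }

  open Enumerated enumerated public using (_≟_; index)

  cancelˡ : ∀ {x y z} → ¬ (x ≡ 0#) → x * y ≡ x * z → y ≡ z
  cancelˡ {x} {y} {z} x≢0 eq = let x⁻¹ , inv = inverse x x≢0 in begin
    y               ≡⟨ *-identityˡ y ⟨
    1# * y          ≡⟨ cong (_* y) inv ⟨
    x * x⁻¹ * y     ≡⟨ solve 3 (λ a b c → a :* b :* c := b :* (a :* c)) refl x x⁻¹ y ⟩
    x⁻¹ * (x * y)   ≡⟨ cong (x⁻¹ *_) eq ⟩
    x⁻¹ * (x * z)   ≡⟨ solve 3 (λ a b c → b :* (a :* c) := a :* b :* c) refl x x⁻¹ z ⟩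
    x * x⁻¹ * z     ≡⟨ cong (_* z) inv ⟩
    1# * z          ≡⟨ *-identityˡ z ⟩
    z               ∎
    where open ≡-Reasoning

  x*y≡0 : ∀ {x y} → x * y ≡ 0# → x ≡ 0# ⊎ y ≡ 0#
  x*y≡0 {x} {y} eq with x ≟ 0#
  ... | yes x≡0 = inj₁ x≡0
  ... | no  x≢0 = inj₂ (cancelˡ x≢0 (trans eq (sym (zeroʳ x))))

  *-nonzero : ∀ {x y} → ¬ (x ≡ 0#) → ¬ (y ≡ 0#) → ¬ (x * y ≡ 0#)
  *-nonzero x≢0 y≢0 eq = Sum.[ x≢0 , y≢0 ] (x*y≡0 eq)

  x-y≡0 : ∀ {x y} → x + - y ≡ 0# → x ≡ y
  x-y≡0 {x} {y} eq = trans (solve 2 (λ x y → x := (x :- y) :+ y) refl x y) (trans (cong (_+ y) eq) (+-identityˡ y))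

  x*x≡y*y : ∀ {x y} → x * x ≡ y * y → x ≡ y ⊎ x ≡ - y
  x*x≡y*y {x} {y} eq with x*y≡0 {x + - y} {x + - (- y)}
      (trans (solve 2 (λ x y → (x :- y) :* (x :- (:- y)) := x :* x :- y :* y) refl x y)
             (trans (cong (_+ - (y * y)) eq) (-‿inverseʳ (y * y))))
  ... | inj₁ p = inj₁ (x-y≡0 p)
  ... | inj₂ p = inj₂ (x-y≡0 p)

  ^-+ : ∀ x m n → x ^ (m ℕ.+ n) ≡ (x ^ m) * (x ^ n)
  ^-+ x zero    n = sym (*-identityˡ _)
  ^-+ x (suc m) n = trans (cong (x *_) (^-+ x m n)) (sym (*-assoc _ _ _))

  ^-distrib-* : ∀ x y n → (x * y) ^ n ≡ (x ^ n) * (y ^ n)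
  ^-distrib-* x y zero    = sym (*-identityˡ 1#)
  ^-distrib-* x y (suc n) = trans (cong ((x * y) *_) (^-distrib-* x y n))
    (solve 4 (λ a b c d → a :* b :* (c :* d) := a :* c :* (b :* d)) refl x y (x ^ n) (y ^ n))

  1^ : ∀ n → 1# ^ n ≡ 1#
  1^ zero    = refl
  1^ (suc n) = trans (*-identityˡ _) (1^ n)

  ^-* : ∀ x m n → x ^ (m ℕ.* n) ≡ (x ^ m) ^ n
  ^-* x zero    n = sym (1^ n)
  ^-* x (suc m) n = trans (^-+ x n (m ℕ.* n)) (trans (cong (x ^ n *_) (^-* x m n)) (sym (^-distrib-* x (x ^ m) n)))

  ^-comm : ∀ x m n → (x ^ m) ^ n ≡ (x ^ n) ^ m
  ^-comm x m n = trans (sym (^-* x m n)) (trans (cong (x ^_) (ℕ.*-comm m n)) (^-* x n m))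

  x^n≡0 : ∀ {x} n → x ^ n ≡ 0# → x ≡ 0#
  x^n≡0 zero    eq = contradiction (sym eq) 0≢1
  x^n≡0 (suc n) eq = Sum.[ (λ p → p) , x^n≡0 n ] (x*y≡0 eq)

  ×-* : ∀ n x → n × x ≡ (n × 1#) * x
  ×-* zero    x = sym (zeroˡ x)
  ×-* (suc n) x = trans (cong₂ _+_ (sym (*-identityˡ x)) (×-* n x)) (sym (distribʳ x 1# (n × 1#)))

  ×-^ : ∀ m n → (m ℕ.^ n) × 1# ≡ (m × 1#) ^ n
  ×-^ m zero    = +-identityʳ 1#
  ×-^ m (suc n) = trans (×1-homo-* m (m ℕ.^ n)) (cong (m × 1# *_) (×-^ m n))

  -- Serves for translation by 1 on the whole field and for multiplication by a unit on the nonzero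
  -- elements. The sum or product of the list is compared before and after.
  map-injective-↭ : ∀ {f : Carrier → Carrier} {xs} → Injective _≡_ _≡_ f → Unique xs →
                    (∀ {x} → x ∈ xs → f x ∈ xs) → (∀ {y} → y ∈ xs → ∃ λ x → (x ∈ xs) ∧ (f x ≡ y)) → map f xs ↭ xs
  map-injective-↭ {f} inj u into onto = Unique-↭ (Unique.map⁺ inj u) u into′ (λ y∈ → let x , x∈ , eq = onto y∈ in subst (_∈ map f _) eq (∈-map⁺ f x∈))
    where
    into′ : ∀ {y} → y ∈ map f _ → y ∈ _
    into′ y∈ = let x , x∈ , eq = ∈-map⁻ f y∈ in subst (_∈ _) (sym eq) (into x∈)

  sum-map-+ : ∀ a xs → foldr _+_ 0# (map (a +_) xs) ≡ length xs × a + foldr _+_ 0# xs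
  sum-map-+ a []       = sym (+-identityˡ 0#)
  sum-map-+ a (x ∷ xs) = trans (cong (a + x +_) (sum-map-+ a xs))
    (solve 4 (λ a x n s → a :+ x :+ (n :+ s) := a :+ n :+ (x :+ s)) refl a x (length xs × a) (foldr _+_ 0# xs))

  product-map-* : ∀ a xs → foldr _*_ 1# (map (a *_) xs) ≡ (a ^ length xs) * foldr _*_ 1# xs
  product-map-* a []       = sym (*-identityˡ 1#)
  product-map-* a (x ∷ xs) = trans (cong (a * x *_) (product-map-* a xs))
    (solve 4 (λ a x n s → a :* x :* (n :* s) := a :* n :* (x :* s)) refl a x (a ^ length xs) (foldr _*_ 1# xs))

  sum-↭ : ∀ {xs ys} → xs ↭ ys → foldr _+_ 0# xs ≡ foldr _+_ 0# ys
  sum-↭ eq = PermSetoid.foldr-commMonoid (setoid Carrier) (CommutativeRing.+-isCommutativeMonoid commutativeRing) (↭⇒↭ₛ eq)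

  product-↭ : ∀ {xs ys} → xs ↭ ys → foldr _*_ 1# xs ≡ foldr _*_ 1# ys
  product-↭ eq = PermSetoid.foldr-commMonoid (setoid Carrier) (CommutativeRing.*-isCommutativeMonoid commutativeRing) (↭⇒↭ₛ eq)

  +-cancelˡ : ∀ a {x y} → a + x ≡ a + y → x ≡ y
  +-cancelˡ a {x} {y} eq = trans (lemma x) (trans (cong (- a +_) eq) (sym (lemma y)))
    where
    lemma : ∀ x → x ≡ - a + (a + x)
    lemma x = solve 2 (λ a x → x := :- a :+ (a :+ x)) refl a x

  -- Translation by 1 permutes the field, so the sum s of all elements equals |K| · 1 + s.
  order×1≡0 : order × 1# ≡ 0#
  order×1≡0 = +-cancelˡ s (trans (+-comm s _) (trans (sym (sum-map-+ 1# elements)) (trans (sum-↭ shift) (sym (+-identityʳ s)))))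
    where
    s = foldr _+_ 0# elements
    shift : map (1# +_) elements ↭ elements
    shift = map-injective-↭ (+-cancelˡ 1#) elements-unique (λ _ → elements-complete _)
      (λ {y} _ → y + - 1# , elements-complete _ , solve 2 (λ o y → o :+ (y :- o) := y) refl 1# y)

  nonzeros : List Carrier
  nonzeros = filter (λ x → ¬? (x ≟ 0#)) elements

  nonzeros-unique : Unique nonzeros
  nonzeros-unique = Unique.filter⁺ (λ x → ¬? (x ≟ 0#)) elements-unique

  ∈-nonzeros : ∀ {x} → ¬ (x ≡ 0#) → x ∈ nonzeros
  ∈-nonzeros x≢0 = ∈-filter⁺ (λ x → ¬? (x ≟ 0#)) (elements-complete _) x≢0

  ∈-nonzeros⁻ : ∀ {x} → x ∈ nonzeros → ¬ (x ≡ 0#)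
  ∈-nonzeros⁻ x∈ = proj₂ (∈-filter⁻ (λ x → ¬? (x ≟ 0#)) {xs = elements} x∈)

  order≡1+nonzeros : order ≡ suc (length nonzeros)
  order≡1+nonzeros = ↭-length (Unique-↭ {ys = 0# ∷ nonzeros} elements-unique
    (All.tabulate (λ x∈ 0≡x → ∈-nonzeros⁻ x∈ (sym 0≡x)) ∷ nonzeros-unique) split (λ _ → elements-complete _))
    where
    split : ∀ {x} → x ∈ elements → x ∈ 0# ∷ nonzeros
    split {x} _ with x ≟ 0#
    ... | yes x≡0 = here x≡0
    ... | no  x≢0 = there (∈-nonzeros x≢0)

  -- Multiplication by x permutes the nonzero elements, so their product P satisfies x^n P = P, and
  -- P is nonzero.
  x^[order-1] : ∀ {n x} → order ≡ suc n → ¬ (x ≡ 0#) → x ^ n ≡ 1#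
  x^[order-1] {n} {x} order≡ x≢0 = cancelˡ product≢0 (begin
    P * (x ^ n)                             ≡⟨ *-comm P _ ⟩
    (x ^ n) * P                             ≡⟨ cong (λ k → (x ^ k) * P) (ℕ.suc-injective (trans (sym order≡) order≡1+nonzeros)) ⟩
    (x ^ length nonzeros) * P               ≡⟨ product-map-* x nonzeros ⟨
    foldr _*_ 1# (map (x *_) nonzeros)      ≡⟨ product-↭ shift ⟩
    P                                       ≡⟨ *-identityʳ P ⟨
    P * 1#                                  ∎)
    where
    open ≡-Reasoning
    P = foldr _*_ 1# nonzeros
    product-nonzero : ∀ {xs} → (∀ {x} → x ∈ xs → ¬ (x ≡ 0#)) → ¬ (foldr _*_ 1# xs ≡ 0#)
    product-nonzero {[]}     _  eq = 0≢1 (sym eq)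
    product-nonzero {x ∷ xs} nz eq = *-nonzero (nz (here refl)) (product-nonzero (nz ∘ there)) eq
    product≢0 : ¬ (P ≡ 0#)
    product≢0 = product-nonzero ∈-nonzeros⁻
    divide : ∀ y → ∃ λ z → x * z ≡ y
    divide y = let x⁻¹ , inv = inverse x x≢0 in x⁻¹ * y ,
      trans (sym (*-assoc x x⁻¹ y)) (trans (cong (_* y) inv) (*-identityˡ y))
    shift : map (x *_) nonzeros ↭ nonzeros
    shift = map-injective-↭ (cancelˡ x≢0) nonzeros-unique (λ y∈ → ∈-nonzeros (*-nonzero x≢0 (∈-nonzeros⁻ y∈)))
      (λ {y} y∈ → let z , xz≡y = divide y in
        z , ∈-nonzeros (λ z≡0 → ∈-nonzeros⁻ y∈ (trans (sym xz≡y) (trans (cong (x *_) z≡0) (zeroʳ x)))) , xz≡y)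

  x^order : ∀ x → x ^ order ≡ x
  x^order x with x ≟ 0#
  ... | no  x≢0 = trans (cong (x ^_) order≡1+nonzeros) (trans (cong (x *_) (x^[order-1] order≡1+nonzeros x≢0)) (*-identityʳ x))
  ... | yes refl = trans (cong (0# ^_) order≡1+nonzeros) (zeroˡ _)

  private module Exp′ = Exp commutativeSemiring

  ^≡Exp : ∀ x n → x ^ n ≡ x Exp′.^ n
  ^≡Exp x zero    = refl
  ^≡Exp x (suc n) = cong (x *_) (^≡Exp x n)

  -- The n-th power of p · 1 is p^n · 1 = |K| · 1 = 0, and a field has no nilpotent elements besides
  -- 0.
  p×1≡0 : ∀ {p} n → order ≡ p ℕ.^ n → p × 1# ≡ 0#
  p×1≡0 {p} n order≡ = x^n≡0 n (trans (sym (×-^ p n)) (trans (cong (_× 1#) (sym order≡)) order×1≡0))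

-- Characteristic p and Frobenius maps

module Characteristic (K : FiniteField) (p : ℕ) (p-prime : Prime p)
  (p×1 : FieldTheory._×_ K p (FiniteField.1# K) ≡ FiniteField.0# K) where
  open FieldTheory K

  p∣⇒×≡0 : ∀ {n} → p ∣ n → ∀ x → n × x ≡ 0#
  p∣⇒×≡0 (divides k refl) x = begin
    (k ℕ.* p) × x              ≡⟨ ×-* (k ℕ.* p) x ⟩
    ((k ℕ.* p) × 1#) * x       ≡⟨ cong (_* x) (×1-homo-* k p) ⟩
    (k × 1#) * (p × 1#) * x    ≡⟨ cong (λ z → (k × 1#) * z * x) p×1 ⟩
    (k × 1#) * 0# * x          ≡⟨ cong (_* x) (zeroʳ _) ⟩
    0# * x                     ≡⟨ zeroˡ x ⟩
    0#                         ∎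
    where open ≡-Reasoning

  frobenius-+ : ∀ x y → (x + y) ^ p ≡ (x ^ p) + (y ^ p)
  -- The copy `p′` can be split into zero and successor, which puts the module parameter p into the
  -- form `suc p′`.
  frobenius-+ = go refl
    where
    open ≡-Reasoning
    open MonoidSum (CommutativeRing.+-monoid commutativeRing) using (sum; sum-init-last; sum-cong-≗; sum-replicate-zero)
    open Binomial commutativeSemiring using (theorem; binomialTerm)
    module E = Exp commutativeSemiring
    go : ∀ {p′} → p ≡ p′ → ∀ x y → (x + y) ^ p′ ≡ (x ^ p′) + (y ^ p′)
    go {zero}   refl = ⊥-elim (ℕ.≢-nonZero⁻¹ 0 {{prime⇒nonZero p-prime}} refl)
    go {suc p′} refl x y = begin
      (x + y) ^ p                                      ≡⟨ ^≡Exp (x + y) p ⟩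
      (x + y) E.^ p                                    ≡⟨ theorem p x y ⟩
      -- The terms at 0 and p, which are y^p and x^p, are split off; every term between them has a
      -- binomial coefficient divisible by p.
      t zero + sum (λ i → t (suc i))                   ≡⟨ cong (t zero +_) (sum-init-last (λ i → t (suc i))) ⟩
      t zero + (sum (λ i → t (suc (inject₁ i))) + t (suc (fromℕ p′)))
        ≡⟨ cong (λ z → t zero + (z + t (suc (fromℕ p′)))) (trans (sum-cong-≗ middle) (sum-replicate-zero p′)) ⟩
      t zero + (0# + t (suc (fromℕ p′)))               ≡⟨ cong₂ (λ a b → a + (0# + b)) first last ⟩
      (y ^ p) + (0# + (x ^ p))                         ≡⟨ solve 2 (λ a b → b :+ (con (pos 0) :+ a) := a :+ b) refl (x ^ p) (y ^ p) ⟩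
      (x ^ p) + (y ^ p)                                ∎
      where
      t = binomialTerm x y p
      middle : ∀ i → t (suc (inject₁ i)) ≡ 0#
      middle i = p∣⇒×≡0 (p∣pCk p-prime (ℕ.s≤s ℕ.z≤n) (ℕ.s≤s (subst (ℕ._< p′) (sym (Fin.toℕ-inject₁ i)) (Fin.toℕ<n i)))) _
      first : t zero ≡ y ^ p
      first = trans (+-identityʳ _) (trans (*-identityˡ _) (sym (^≡Exp y p)))
      last : t (suc (fromℕ p′)) ≡ x ^ p
      last = begin
        (p C suc (toℕ (fromℕ p′))) × ((x E.^ suc (toℕ (fromℕ p′))) * (y E.^ (p′ ℕ.∸ toℕ (fromℕ p′))))
          ≡⟨ cong (λ k → (p C suc k) × ((x E.^ suc k) * (y E.^ (p′ ℕ.∸ k)))) (Fin.toℕ-fromℕ p′) ⟩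
        (p C p) × ((x E.^ p) * (y E.^ (p′ ℕ.∸ p′)))
          ≡⟨ cong₂ (λ c k → c × ((x E.^ p) * (y E.^ k))) (nCn≡1 p) (ℕ.n∸n≡0 p′) ⟩
        (x E.^ p) * 1# + 0#     ≡⟨ +-identityʳ _ ⟩
        (x E.^ p) * 1#          ≡⟨ *-identityʳ _ ⟩
        x E.^ p                 ≡⟨ ^≡Exp x p ⟨
        x ^ p                   ∎

  frobenius^-+ : ∀ n x y → (x + y) ^ (p ℕ.^ n) ≡ (x ^ (p ℕ.^ n)) + (y ^ (p ℕ.^ n))
  frobenius^-+ zero    x y = trans (*-identityʳ _) (sym (cong₂ _+_ (*-identityʳ x) (*-identityʳ y)))
  frobenius^-+ (suc n) x y = begin
    (x + y) ^ (p ℕ.* p ℕ.^ n)                        ≡⟨ ^-* (x + y) p (p ℕ.^ n) ⟩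
    ((x + y) ^ p) ^ (p ℕ.^ n)                        ≡⟨ cong (_^ (p ℕ.^ n)) (frobenius-+ x y) ⟩
    ((x ^ p) + (y ^ p)) ^ (p ℕ.^ n)                  ≡⟨ frobenius^-+ n (x ^ p) (y ^ p) ⟩
    ((x ^ p) ^ (p ℕ.^ n)) + ((y ^ p) ^ (p ℕ.^ n))    ≡⟨ cong₂ _+_ (^-* x p (p ℕ.^ n)) (^-* y p (p ℕ.^ n)) ⟨
    (x ^ (p ℕ.^ suc n)) + (y ^ (p ℕ.^ suc n))        ∎
    where open ≡-Reasoning

  -- If p did not divide n, the two would be coprime, and a Bézout identity would express 1 through
  -- p · 1 and n · 1, both zero. The double negation disappears later through decidability of
  -- divisibility.
  ×≡0⇒p∣ : ∀ {n} → n × 1# ≡ 0# → ¬ ¬ (p ∣ n)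
  ×≡0⇒p∣ {n} n×1 p∤n = bézout (coprime-Bézout coprime)
    where
    coprime : Coprime p n
    coprime {d} (d∣p , d∣n) = Sum.[ (λ d≡1 → d≡1) , (λ d≡p → contradiction (subst (_∣ n) d≡p d∣n) p∤n) ]′ (prime⇒irreducible p-prime d∣p)
    absurd : ∀ a b c d → c × 1# ≡ 0# → d × 1# ≡ 0# → ¬ (1 ℕ.+ a ℕ.* c ≡ b ℕ.* d)
    absurd a b c d c≡0 d≡0 eq = 0≢1 (begin
      0#                         ≡⟨ vanish b d d≡0 ⟨
      (b ℕ.* d) × 1#             ≡⟨ cong (_× 1#) eq ⟨
      1# + (a ℕ.* c) × 1#        ≡⟨ cong (1# +_) (vanish a c c≡0) ⟩
      1# + 0#                    ≡⟨ +-identityʳ 1# ⟩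
      1#                         ∎)
      where
      open ≡-Reasoning
      vanish : ∀ a c → c × 1# ≡ 0# → (a ℕ.* c) × 1# ≡ 0#
      vanish a c c≡0 = trans (×1-homo-* a c) (trans (cong (a × 1# *_) c≡0) (zeroʳ _))
    bézout : ¬ Bézout.Identity 1 p n
    bézout (Bézout.+- x y eq) = absurd y x n p n×1 p×1 eq
    bézout (Bézout.-+ x y eq) = absurd x y p n p×1 n×1 eq

  -- With p = 2h + 1, adding h copies of x + x = 0 to x gives p x = 0.
  x+x≡0 : ¬ (2 ∣ p) → ∀ {x} → x + x ≡ 0# → x ≡ 0#
  x+x≡0 2∤p {x} eq = begin
    x                                  ≡⟨ solve 2 (λ x y → x := x :+ y :* con (pos 0)) refl x (proj₁ h-odd × 1#) ⟩
    x + (h × 1#) * 0#                  ≡⟨ cong (λ z → x + (h × 1#) * z) eq ⟨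
    x + (h × 1#) * (x + x)             ≡⟨ solve 2 (λ x y → x :+ y :* (x :+ x) := (con (pos 1) :+ y :* (con (pos 1) :+ (con (pos 1) :+ con (pos 0)))) :* x) refl x (h × 1#) ⟩
    (1# + (h × 1#) * (2 × 1#)) * x     ≡⟨ cong (λ z → (1# + z) * x) (×1-homo-* h 2) ⟨
    (suc (h ℕ.* 2) × 1#) * x           ≡⟨ cong (λ n → (n × 1#) * x) p≡ ⟨
    (p × 1#) * x                       ≡⟨ cong (_* x) p×1 ⟩
    0# * x                             ≡⟨ zeroˡ x ⟩
    0#                                 ∎
    where
    open ≡-Reasoning
    h-odd = odd 2∤p
    h = proj₁ h-odd
    p≡ = proj₂ h-odd

  module Additivity {f : Carrier → Carrier} (f-+ : ∀ x y → f (x + y) ≡ f x + f y) where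
    f-0 : f 0# ≡ 0#
    f-0 = sym (+-cancelˡ (f 0#) (trans (+-identityʳ _) (trans (sym (cong f (+-identityʳ 0#))) (f-+ 0# 0#))))

    f-neg : ∀ x → f (- x) ≡ - f x
    f-neg x = +-cancelˡ (f x) (trans (sym (f-+ x (- x))) (trans (cong f (-‿inverseʳ x)) (trans f-0 (sym (-‿inverseʳ (f x))))))

-- Polynomials, Euler's criterion and the embedding E → K

module Polynomials (K : FiniteField) where
  open FieldTheory K

  eval : ∀ {n} → Vec Carrier n → Carrier → Carrier
  eval []       x = 0#
  eval (c ∷ cs) x = c + x * eval cs x

  -- Synthetic division by X - r, constant term first: each coefficient of the quotient is the value
  -- at r of the tail one place further up, and the remainder is the value of the whole list.
  quotient : ∀ {n} → Carrier → Vec Carrier (suc n) → Vec Carrier n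
  quotient r (c ∷ [])     = []
  quotient r (c ∷ d ∷ cs) = eval (d ∷ cs) r ∷ quotient r (d ∷ cs)

  eval-quotient : ∀ {n} r (cs : Vec Carrier (suc n)) x →
                  eval cs x ≡ eval cs r + (x + - r) * eval (quotient r cs) x
  eval-quotient r (c ∷ []) x =
    solve 3 (λ c r x → c :+ x :* con (pos 0) := c :+ r :* con (pos 0) :+ (x :- r) :* con (pos 0)) refl c r x
  eval-quotient r (c ∷ d ∷ cs) x = trans
    (cong (λ z → c + x * z) (eval-quotient r (d ∷ cs) x))
    (solve 5 (λ c r x e q → c :+ x :* (e :+ (x :- r) :* q) := c :+ r :* e :+ (x :- r) :* (e :+ x :* q)) refl
      c r x (eval (d ∷ cs) r) (eval (quotient r (d ∷ cs)) x))

  eval-zero : ∀ {n} (cs : Vec Carrier n) → (∀ j → Vec.lookup cs j ≡ 0#) → ∀ x → eval cs x ≡ 0#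
  eval-zero []       _    x = refl
  eval-zero (c ∷ cs) zero′ x = trans (cong₂ (λ a b → a + x * b) (zero′ zero) (eval-zero cs (zero′ ∘ suc) x))
    (trans (+-identityˡ _) (zeroʳ x))

  -- The first coefficient of the quotient is the value at r of the tail, so its vanishing kills the
  -- constant term and passes the root on to the tail.
  quotient-zero : ∀ {n} r (cs : Vec Carrier (suc n)) → eval cs r ≡ 0# →
                  (∀ j → Vec.lookup (quotient r cs) j ≡ 0#) → ∀ j → Vec.lookup cs j ≡ 0#
  quotient-zero r (c ∷ []) root _ zero = trans (solve 2 (λ c r → c := c :+ r :* con (pos 0)) refl c r) root
  quotient-zero r (c ∷ d ∷ cs) root zero′ zero =
    trans (trans (solve 2 (λ c r → c := c :+ r :* con (pos 0)) refl c r) (cong (λ z → c + r * z) (sym (zero′ zero)))) root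
  quotient-zero r (c ∷ d ∷ cs) root zero′ (suc j) = quotient-zero r (d ∷ cs) (zero′ zero) (zero′ ∘ suc) j

  -- Division by X - r for the first root r leaves every other root s a root of the quotient,
  -- because s - r is nonzero. The quotient has one coefficient fewer.
  roots≥length⇒zero : ∀ {n} (cs : Vec Carrier n) {rs} → Unique rs → n ℕ.≤ length rs →
                      (∀ {r} → r ∈ rs → eval cs r ≡ 0#) → ∀ j → Vec.lookup cs j ≡ 0#
  roots≥length⇒zero (c ∷ cs) {r ∷ rs} (r∉ ∷ u) (s≤s n≤) roots =
    quotient-zero r (c ∷ cs) (roots (here refl)) (roots≥length⇒zero (quotient r (c ∷ cs)) u n≤ root′)
    where
    root′ : ∀ {s} → s ∈ rs → eval (quotient r (c ∷ cs)) s ≡ 0#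
    root′ {s} s∈ with x*y≡0 (trans (sym (+-identityˡ _)) (trans (cong (_+ (s + - r) * eval (quotient r (c ∷ cs)) s) (sym (roots (here refl))))
                       (trans (sym (eval-quotient r (c ∷ cs) s)) (roots (there s∈)))))
    ... | inj₁ s-r≡0 = contradiction (sym (x-y≡0 s-r≡0)) (All.lookup r∉ s∈)
    ... | inj₂ root  = root

  -- Exhaustive search in place of excluded middle. The negative answer is a predicate of its own so
  -- that `searchVec` can nest searches, feeding the outcome of the inner one to the outer one.
  search : ∀ {P Q : Carrier → Set} → (∀ x → P x ⊎ Q x) → ∃ P ⊎ (∀ x → Q x)
  search {P} {Q} decide = Sum.map₂ (λ all x → All.lookup all (elements-complete x)) (go elements)
    where
    go : ∀ xs → ∃ P ⊎ All Q xs
    go []       = inj₂ []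
    go (x ∷ xs) with decide x | go xs
    ... | inj₁ p | _       = inj₁ (x , p)
    ... | inj₂ _ | inj₁ p  = inj₁ p
    ... | inj₂ q | inj₂ qs = inj₂ (q ∷ qs)

  searchVec : ∀ n {P Q : Vec Carrier n → Set} → (∀ v → P v ⊎ Q v) → ∃ P ⊎ (∀ v → Q v)
  searchVec zero    decide = Sum.map ([] ,_) (λ { q [] → q }) (decide [])
  searchVec (suc n) decide = Sum.map (λ (x , v , p) → x ∷ v , p) (λ { q (x ∷ v) → q x v })
    (search (λ x → searchVec n (λ v → decide (x ∷ v))))

  -- (y² − a)(a^(h−1) + a^(h−2) y² + ⋯ + y^(2h−2)) = y^(2h) − a^h
  geometric : Carrier → ∀ h → Vec Carrier (h ℕ.* 2)
  geometric a zero    = []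
  geometric a (suc h) = a ^ h ∷ 0# ∷ geometric a h

  eval-geometric : ∀ a h y → (y * y + - a) * eval (geometric a h) y ≡ (y ^ (h ℕ.* 2)) + - (a ^ h)
  eval-geometric a zero y = solve 2 (λ y a → (y :* y :- a) :* con (pos 0) := con (pos 1) :- con (pos 1)) refl y a
  eval-geometric a (suc h) y = begin
    (y * y + - a) * (a ^ h + y * (0# + y * e))
      ≡⟨ solve 4 (λ y a A e → (y :* y :- a) :* (A :+ y :* (con (pos 0) :+ y :* e)) := (y :* y :- a) :* A :+ y :* y :* ((y :* y :- a) :* e)) refl y a (a ^ h) e ⟩
    (y * y + - a) * (a ^ h) + y * y * ((y * y + - a) * e)
      ≡⟨ cong (λ z → (y * y + - a) * (a ^ h) + y * y * z) (eval-geometric a h y) ⟩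
    (y * y + - a) * (a ^ h) + y * y * ((y ^ (h ℕ.* 2)) + - (a ^ h))
      ≡⟨ solve 4 (λ y a A Y → (y :* y :- a) :* A :+ y :* y :* (Y :- A) := y :* (y :* Y) :- a :* A) refl y a (a ^ h) (y ^ (h ℕ.* 2)) ⟩
    y * (y * (y ^ (h ℕ.* 2))) + - (a * (a ^ h)) ∎
    where
    open ≡-Reasoning
    e = eval (geometric a h) y

  order≢1 : ¬ (order ≡ 1)
  order≢1 order≡1 = 0≢1 (Enumerated.index-injective enumerated (Fin-subsingleton order≡1 (index 0#) (index 1#)))
    where
    Fin-subsingleton : ∀ {n} → n ≡ 1 → (i j : Fin n) → i ≡ j
    Fin-subsingleton refl zero zero = refl

  -- The constant coefficient is a^(h-1), and a times it is a^h = 1. For h = 0 the field would have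
  -- a single element.
  geometric≢0 : ∀ {h a} → order ≡ suc (h ℕ.* 2) → a ^ h ≡ 1# → ¬ (∀ j → Vec.lookup (geometric a h) j ≡ 0#)
  geometric≢0 {zero}      order≡1 _   _     = order≢1 order≡1
  geometric≢0 {suc h} {a} _       a^h zero′ = 0≢1 (trans (sym (trans (cong (a *_) (zero′ zero)) (zeroʳ a))) a^h)

  -- If y² - a never vanished, each of the 2h nonzero y would be a root of `geometric a h`, since
  -- y^(2h) - a^h = 1 - 1 = 0. A list of 2h coefficients with that many roots is zero, which
  -- `geometric≢0` excludes.
  euler : ∀ {h a} → order ≡ suc (h ℕ.* 2) → a ^ h ≡ 1# → IsSquare a
  euler {h} {a} order≡ a^h≡1 = Sum.[ (λ square → square) , (λ nonsquare → ⊥-elim (absurd nonsquare)) ]′ (search decide)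
    where
    decide : ∀ y → y * y ≡ a ⊎ ¬ (y * y ≡ a)
    decide y = toSum (y * y ≟ a)
    module _ (nonsquare : ∀ y → ¬ (y * y ≡ a)) where
      root : ∀ {y} → ¬ (y ≡ 0#) → eval (geometric a h) y ≡ 0#
      root {y} y≢0 = Sum.[ (λ eq → contradiction (x-y≡0 eq) (nonsquare y)) , (λ eq → eq) ] (x*y≡0 product≡0)
        where
        product≡0 : (y * y + - a) * eval (geometric a h) y ≡ 0#
        product≡0 = trans (eval-geometric a h y)
          (trans (cong₂ (λ u v → u + - v) (x^[order-1] order≡ y≢0) a^h≡1) (-‿inverseʳ 1#))
      length≡ : h ℕ.* 2 ≡ length nonzeros
      length≡ = ℕ.suc-injective (trans (sym order≡) order≡1+nonzeros)
      absurd : ⊥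
      absurd = geometric≢0 {h} order≡ a^h≡1
        (roots≥length⇒zero (geometric a h) nonzeros-unique (ℕ.≤-reflexive length≡) (λ r∈ → root (∈-nonzeros⁻ r∈)))

-- Polynomial expressions over ℕ and their reduction

infixl 6 _⊞_
infixl 7 _⊠_

-- Coefficients in ℕ allow one expression to be evaluated in both E and K. Negation is expressed
-- later by the coefficient -1 modulo the characteristic.
data Term (n : ℕ) : Set where
  const   : ℕ → Term n
  var     : Fin n → Term n
  _⊞_ _⊠_ : Term n → Term n → Term n

powerᵗ : ∀ {n} → Term n → ℕ → Term n
powerᵗ t zero    = const 1
powerᵗ t (suc m) = t ⊠ powerᵗ t m

productᵗ : ∀ {n} {A : Set} → (A → Term n) → List A → Term n
productᵗ f []       = const 1
productᵗ f (x ∷ xs) = f x ⊠ productᵗ f xs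

value : Term 0 → ℕ
value (const a) = a
value (s ⊞ t)   = value s ℕ.+ value t
value (s ⊠ t)   = value s ℕ.* value t

-- For c = 0 this is multiplication by x at constant length: coefficients move up one place and the
-- top one is handed back separately.
rotate : ∀ {A : Set} {n} → A → Vec A n → Vec A n ∧ A
rotate c []       = [] , c
rotate c (d ∷ ds) = let es , l = rotate d ds in c ∷ es , l

-- Coefficients, as terms in the remaining variables, of a term viewed as a polynomial in
-- its first variable x and reduced modulo x^(2+k) − x.
module Coefficients (k : ℕ) where

  shift : ∀ {n} → Vec (Term n) (2 ℕ.+ k) → Vec (Term n) (2 ℕ.+ k)
  shift cs with rotate (const 0) cs
  -- The overflow l x^(2+k) is congruent to l x, so l is added to the coefficient of x.
  ... | e₀ ∷ e₁ ∷ es , l = e₀ ∷ e₁ ⊞ l ∷ es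

  multiply : ∀ {n j} → Vec (Term n) j → Vec (Term n) (2 ℕ.+ k) → Vec (Term n) (2 ℕ.+ k)
  multiply []       ds = replicate _ (const 0)
  multiply (c ∷ cs) ds = zipWith _⊞_ (Vec.map (c ⊠_) ds) (shift (multiply cs ds))

  coefficients : ∀ {n} → Term (suc n) → Vec (Term n) (2 ℕ.+ k)
  coefficients (const a)     = const a ∷ replicate _ (const 0)
  -- A length of at least 2 guarantees a place for the coefficient of x.
  coefficients (var zero)    = const 0 ∷ const 1 ∷ replicate _ (const 0)
  coefficients (var (suc i)) = var i ∷ replicate _ (const 0)
  coefficients (s ⊞ t)       = zipWith _⊞_ (coefficients s) (coefficients t)
  coefficients (s ⊠ t)       = multiply (coefficients s) (coefficients t)

module Semantics (K : FiniteField) where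
  open FieldTheory K
  open Polynomials K

  ⟦_⟧ : ∀ {n} → Term n → Vec Carrier n → Carrier
  ⟦ const a ⟧ ρ = a × 1#
  ⟦ var i ⟧   ρ = Vec.lookup ρ i
  ⟦ s ⊞ t ⟧   ρ = ⟦ s ⟧ ρ + ⟦ t ⟧ ρ
  ⟦ s ⊠ t ⟧   ρ = ⟦ s ⟧ ρ * ⟦ t ⟧ ρ

  ⟦value⟧ : ∀ t → ⟦ t ⟧ [] ≡ value t × 1#
  ⟦value⟧ (const a) = refl
  ⟦value⟧ (s ⊞ t)   = trans (cong₂ _+_ (⟦value⟧ s) (⟦value⟧ t)) (sym (×-homo-+ 1# (value s) (value t)))
  ⟦value⟧ (s ⊠ t)   = trans (cong₂ _*_ (⟦value⟧ s) (⟦value⟧ t)) (sym (×1-homo-* (value s) (value t)))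

  ⟦power⟧ : ∀ {n} (t : Term n) m ρ → ⟦ powerᵗ t m ⟧ ρ ≡ ⟦ t ⟧ ρ ^ m
  ⟦power⟧ t zero    ρ = +-identityʳ 1#
  ⟦power⟧ t (suc m) ρ = cong (⟦ t ⟧ ρ *_) (⟦power⟧ t m ρ)

  ⟦product⟧≢0 : ∀ {n} {A : Set} (f : A → Term n) xs ρ → ¬ (⟦ productᵗ f xs ⟧ ρ ≡ 0#) →
                ∀ {x} → x ∈ xs → ¬ (⟦ f x ⟧ ρ ≡ 0#)
  ⟦product⟧≢0 f (x ∷ xs) ρ ≢0 (here refl) eq = ≢0 (trans (cong (_* _) eq) (zeroˡ _))
  ⟦product⟧≢0 f (x ∷ xs) ρ ≢0 (there x∈)     = ⟦product⟧≢0 f xs ρ (λ eq → ≢0 (trans (cong (_ *_) eq) (zeroʳ _))) x∈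

  ⟦product⟧≡1 : ∀ {n} {A : Set} (f : A → Term n) xs ρ → (∀ x → ⟦ f x ⟧ ρ ≡ 1#) → ⟦ productᵗ f xs ⟧ ρ ≡ 1#
  ⟦product⟧≡1 f []       ρ _  = +-identityʳ 1#
  ⟦product⟧≡1 f (x ∷ xs) ρ ≡1 = trans (cong₂ _*_ (≡1 x) (⟦product⟧≡1 f xs ρ ≡1)) (*-identityˡ 1#)

  module _ (k : ℕ) (x^[2+k]≡x : ∀ x → x ^ (2 ℕ.+ k) ≡ x) {n} (ρ : Vec Carrier n) (x : Carrier) where
    open Coefficients k

    ⟪_⟫ : ∀ {j} → Vec (Term n) j → Carrier
    ⟪ cs ⟫ = eval (Vec.map (λ c → ⟦ c ⟧ ρ) cs) x

    ⟪replicate⟫ : ∀ j → ⟪ replicate j (const 0) ⟫ ≡ 0#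
    ⟪replicate⟫ zero    = refl
    ⟪replicate⟫ (suc j) = trans (+-identityˡ _) (trans (cong (x *_) (⟪replicate⟫ j)) (zeroʳ x))

    ⟪const⟫ : ∀ {j} c → ⟪ c ∷ replicate j (const 0) ⟫ ≡ ⟦ c ⟧ ρ
    ⟪const⟫ {j} c = trans (cong (λ z → ⟦ c ⟧ ρ + x * z) (⟪replicate⟫ j)) (trans (cong (⟦ c ⟧ ρ +_) (zeroʳ x)) (+-identityʳ _))

    ⟪zipWith⟫ : ∀ {j} (cs ds : Vec (Term n) j) → ⟪ zipWith _⊞_ cs ds ⟫ ≡ ⟪ cs ⟫ + ⟪ ds ⟫
    ⟪zipWith⟫ []       []       = sym (+-identityˡ 0#)
    ⟪zipWith⟫ (c ∷ cs) (d ∷ ds) = trans (cong (λ z → ⟦ c ⟧ ρ + ⟦ d ⟧ ρ + x * z) (⟪zipWith⟫ cs ds))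
      (solve 5 (λ c d x C D → c :+ d :+ x :* (C :+ D) := c :+ x :* C :+ (d :+ x :* D)) refl (⟦ c ⟧ ρ) (⟦ d ⟧ ρ) x ⟪ cs ⟫ ⟪ ds ⟫)

    ⟪map⟫ : ∀ {j} c (ds : Vec (Term n) j) → ⟪ Vec.map (c ⊠_) ds ⟫ ≡ ⟦ c ⟧ ρ * ⟪ ds ⟫
    ⟪map⟫ c []       = sym (zeroʳ _)
    ⟪map⟫ c (d ∷ ds) = trans (cong (λ z → ⟦ c ⟧ ρ * ⟦ d ⟧ ρ + x * z) (⟪map⟫ c ds))
      (solve 4 (λ c d x D → c :* d :+ x :* (c :* D) := c :* (d :+ x :* D)) refl (⟦ c ⟧ ρ) (⟦ d ⟧ ρ) x ⟪ ds ⟫)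

    ⟪rotate⟫ : ∀ {j} c (ds : Vec (Term n) j) →
               ⟦ c ⟧ ρ + x * ⟪ ds ⟫ ≡ ⟪ proj₁ (rotate c ds) ⟫ + (x ^ j) * ⟦ proj₂ (rotate c ds) ⟧ ρ
    ⟪rotate⟫ c []       = solve 2 (λ c x → c :+ x :* con (pos 0) := con (pos 0) :+ con (pos 1) :* c) refl (⟦ c ⟧ ρ) x
    ⟪rotate⟫ {suc j} c (d ∷ ds) = trans (cong (λ z → ⟦ c ⟧ ρ + x * z) (⟪rotate⟫ d ds))
      (solve 5 (λ c x e y l → c :+ x :* (e :+ y :* l) := c :+ x :* e :+ x :* y :* l) refl
        (⟦ c ⟧ ρ) x ⟪ proj₁ (rotate d ds) ⟫ (x ^ j) (⟦ proj₂ (rotate d ds) ⟧ ρ))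

    ⟪shift⟫ : ∀ cs → ⟪ shift cs ⟫ ≡ x * ⟪ cs ⟫
    ⟪shift⟫ cs with rotate (const 0) cs | ⟪rotate⟫ (const 0) cs
    ... | e₀ ∷ e₁ ∷ es , l | eq = sym (trans (sym (+-identityˡ _)) (trans eq (trans
      (cong (λ z → ⟪ e₀ ∷ e₁ ∷ es ⟫ + z * ⟦ l ⟧ ρ) (x^[2+k]≡x x))
      (solve 5 (λ a b x E l → a :+ x :* (b :+ x :* E) :+ x :* l := a :+ x :* (b :+ l :+ x :* E)) refl
        (⟦ e₀ ⟧ ρ) (⟦ e₁ ⟧ ρ) x ⟪ es ⟫ (⟦ l ⟧ ρ)))))

    ⟪multiply⟫ : ∀ {j} (cs : Vec (Term n) j) ds → ⟪ multiply cs ds ⟫ ≡ ⟪ cs ⟫ * ⟪ ds ⟫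
    ⟪multiply⟫ []       ds = trans (⟪replicate⟫ (2 ℕ.+ k)) (sym (zeroˡ _))
    ⟪multiply⟫ (c ∷ cs) ds = trans (⟪zipWith⟫ (Vec.map (c ⊠_) ds) (shift (multiply cs ds)))
      (trans (cong₂ _+_ (⟪map⟫ c ds) (trans (⟪shift⟫ (multiply cs ds)) (cong (x *_) (⟪multiply⟫ cs ds))))
        (solve 4 (λ c x C D → c :* D :+ x :* (C :* D) := (c :+ x :* C) :* D) refl (⟦ c ⟧ ρ) x ⟪ cs ⟫ ⟪ ds ⟫))

    -- Evaluation does not see the reduction where x^(2+k) = x holds for all x. With 2 + k = |K|
    -- this covers K, and also E, since |K| is the square of |E|.
    ⟪coefficients⟫ : ∀ t → ⟪ coefficients t ⟫ ≡ ⟦ t ⟧ (x ∷ ρ)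
    ⟪coefficients⟫ (const a)     = ⟪const⟫ {suc k} (const a)
    ⟪coefficients⟫ (var zero)    = trans (+-identityˡ _) (trans (cong (x *_) (trans (⟪const⟫ {k} (const 1)) (+-identityʳ 1#))) (*-identityʳ x))
    ⟪coefficients⟫ (var (suc i)) = ⟪const⟫ {suc k} (var i)
    ⟪coefficients⟫ (s ⊞ t)       = trans (⟪zipWith⟫ (coefficients s) (coefficients t)) (cong₂ _+_ (⟪coefficients⟫ s) (⟪coefficients⟫ t))
    ⟪coefficients⟫ (s ⊠ t)       = trans (⟪multiply⟫ (coefficients s) (coefficients t)) (cong₂ _*_ (⟪coefficients⟫ s) (⟪coefficients⟫ t))

-- The embedding of E into K

record Homomorphism (E K : FiniteField) : Set where
  private
    module E = FiniteField E
    module K = FiniteField K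
  field
    φ      : E.Carrier → K.Carrier
    φ-+    : ∀ x y → φ (x E.+ y) ≡ φ x K.+ φ y
    φ-*    : ∀ x y → φ (x E.* y) ≡ φ x K.* φ y
    φ-1    : φ E.1# ≡ K.1#

module Embedding (E K : FiniteField) (p k : ℕ)
  (order-K : FiniteField.order K ≡ 2 ℕ.+ k)
  (E-fixed : ∀ x → FiniteField._^_ E x (2 ℕ.+ k) ≡ x)
  (charE : FieldTheory._×_ E (suc p) (FiniteField.1# E) ≡ FiniteField.0# E)
  (charK : FieldTheory._×_ K (suc p) (FiniteField.1# K) ≡ FiniteField.0# K)
  (K⇒E : ∀ n → FieldTheory._×_ K n (FiniteField.1# K) ≡ FiniteField.0# K →
               FieldTheory._×_ E n (FiniteField.1# E) ≡ FiniteField.0# E)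
  where

  private
    module E where
      open FieldTheory E public
      open Polynomials E public
      open Semantics E public
    module K where
      open FieldTheory K public
      open Polynomials K public
      open Semantics K public
    K-fixed : ∀ x → x K.^ (2 ℕ.+ k) ≡ x
    K-fixed x = trans (cong (x K.^_) (sym order-K)) (K.x^order x)
    n = E.order

  open Coefficients k

  -- Induction on the number of variables. With the other variables fixed in K, the reduced
  -- polynomial has |K| coefficients and |K| roots, so every coefficient vanishes identically on K,
  -- hence on E. Without variables a term is a natural number, and `K⇒E` applies.
  identity-transfer : ∀ {m} (t : Term m) → (∀ ρ → K.⟦ t ⟧ ρ ≡ K.0#) → ∀ ρ → E.⟦ t ⟧ ρ ≡ E.0#
  identity-transfer {zero}  t vanish [] = trans (E.⟦value⟧ t) (K⇒E (value t) (trans (sym (K.⟦value⟧ t)) (vanish [])))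
  identity-transfer {suc m} t vanish (x ∷ ρ) = trans (sym (E.⟪coefficients⟫ k E-fixed ρ x t))
    (E.eval-zero (Vec.map (λ c → E.⟦ c ⟧ ρ) (coefficients t)) (λ j → trans (Vec.lookup-map j (λ c → E.⟦ c ⟧ ρ) (coefficients t))
      (identity-transfer (Vec.lookup (coefficients t) j) (coefficient-vanish j) ρ)) x)
    where
    coefficient-vanish : ∀ j ρ → K.⟦ Vec.lookup (coefficients t) j ⟧ ρ ≡ K.0#
    coefficient-vanish j ρ = trans (sym (Vec.lookup-map j (λ c → K.⟦ c ⟧ ρ) (coefficients t)))
      (K.roots≥length⇒zero (Vec.map (λ c → K.⟦ c ⟧ ρ) (coefficients t)) K.elements-unique
        (ℕ.≤-reflexive (sym order-K)) (λ {r} _ → trans (K.⟪coefficients⟫ k K-fixed ρ r t) (vanish (r ∷ ρ))) j)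

  private
    -- The characteristic is `suc p` in this module, so `const p` has the value -1 in both fields.
    neg : ∀ {m} → Term m → Term m
    neg t = const p ⊠ t

    -- 1 − g^(|K|−1), the indicator of the zero set of g on K.
    indicator : Term n → Term n
    indicator g = const 1 ⊞ neg (powerᵗ g (suc k))

    -- One unknown for each element x of E, standing for the image of x under the map sought.
    X : E.Carrier → Term n
    X x = var (E.index x)

    sum-relation product-relation : E.Carrier → E.Carrier → Term n
    sum-relation     x y = X (x E.+ y) ⊞ neg (X x ⊞ X y)
    product-relation x y = X (x E.* y) ⊞ neg (X x ⊠ X y)
    one-relation : Term n
    one-relation = X E.1# ⊞ neg (const 1)

    homomorphism-indicator : Term n
    homomorphism-indicator = productᵗ (λ x → productᵗ (λ y → indicator (sum-relation x y) ⊠ indicator (product-relation x y)) E.elements) E.elements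
                             ⊠ indicator one-relation

    module _ (F : FiniteField) (p×1 : FieldTheory._×_ F (suc p) (FiniteField.1# F) ≡ FiniteField.0# F) where
      open FieldTheory F
      open Semantics F

      x+px≡0 : ∀ x → x + (p × 1#) * x ≡ 0#
      x+px≡0 x = trans (cong (_+ (p × 1#) * x) (sym (*-identityˡ x))) (trans (sym (distribʳ x 1# (p × 1#))) (trans (cong (_* x) p×1) (zeroˡ x)))

      ⟦neg⟧ : ∀ {m} (s t : Term m) ρ → ⟦ s ⟧ ρ ≡ ⟦ t ⟧ ρ → ⟦ s ⊞ neg t ⟧ ρ ≡ 0#
      ⟦neg⟧ s t ρ eq = trans (cong (_+ (p × 1#) * ⟦ t ⟧ ρ) eq) (x+px≡0 (⟦ t ⟧ ρ))

      ⟦neg⟧⁻ : ∀ {m} (s t : Term m) ρ → ⟦ s ⊞ neg t ⟧ ρ ≡ 0# → ⟦ s ⟧ ρ ≡ ⟦ t ⟧ ρ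
      ⟦neg⟧⁻ s t ρ eq = +-cancelˡ ((p × 1#) * ⟦ t ⟧ ρ) (trans (+-comm _ _) (trans eq (sym (trans (+-comm _ _) (x+px≡0 (⟦ t ⟧ ρ))))))

      indicator-zero : ∀ g ρ → ⟦ g ⟧ ρ ≡ 0# → ⟦ indicator g ⟧ ρ ≡ 1#
      indicator-zero g ρ eq = begin
        1# + 0# + (p × 1#) * (⟦ g ⟧ ρ * ⟦ powerᵗ g k ⟧ ρ)   ≡⟨ cong (λ z → 1# + 0# + (p × 1#) * (z * ⟦ powerᵗ g k ⟧ ρ)) eq ⟩
        1# + 0# + (p × 1#) * (0# * ⟦ powerᵗ g k ⟧ ρ)        ≡⟨ cong (λ z → 1# + 0# + (p × 1#) * z) (zeroˡ _) ⟩
        1# + 0# + (p × 1#) * 0#                             ≡⟨ cong (1# + 0# +_) (zeroʳ _) ⟩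
        1# + 0# + 0#                                        ≡⟨ +-identityʳ _ ⟩
        1# + 0#                                             ≡⟨ +-identityʳ _ ⟩
        1#                                                  ∎
        where open ≡-Reasoning

      -- A nonzero value of g has (|F| - 1)-th power 1, which makes the indicator vanish. In
      -- contrast to `indicator-zero` this depends on the order of the field, and it is applied to K
      -- only.
      indicator-nonzero : order ≡ 2 ℕ.+ k → ∀ g ρ → ¬ (⟦ indicator g ⟧ ρ ≡ 0#) → ⟦ g ⟧ ρ ≡ 0#
      indicator-nonzero order≡ g ρ ≢0 = decidable-stable (⟦ g ⟧ ρ ≟ 0#) λ g≢0 → ≢0
        (⟦neg⟧ (const 1) (powerᵗ g (suc k)) ρ
          (trans (+-identityʳ 1#) (sym (trans (⟦power⟧ g (suc k) ρ) (x^[order-1] order≡ g≢0)))))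

      factors : ∀ {m} (s t : Term m) ρ → ¬ (⟦ s ⊠ t ⟧ ρ ≡ 0#) → ¬ (⟦ s ⟧ ρ ≡ 0#) ∧ ¬ (⟦ t ⟧ ρ ≡ 0#)
      factors s t ρ ≢0 = (λ eq → ≢0 (trans (cong (_* ⟦ t ⟧ ρ) eq) (zeroˡ _))) , (λ eq → ≢0 (trans (cong (⟦ s ⟧ ρ *_) eq) (zeroʳ _)))

    -- The identity map of E as a valuation of the unknowns; it satisfies all the relations.
    generic : Vec E.Carrier n
    generic = tabulate (lookup E.elements)

    ⟦X⟧-generic : ∀ x → E.⟦ X x ⟧ generic ≡ x
    ⟦X⟧-generic x = trans (Vec.lookup∘tabulate (lookup E.elements) (E.index x)) (sym (lookup-index (E.elements-complete x)))

    homomorphism-indicator-generic : E.⟦ homomorphism-indicator ⟧ generic ≡ E.1#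
    homomorphism-indicator-generic = trans (cong₂ E._*_
      (E.⟦product⟧≡1 _ E.elements generic (λ x → E.⟦product⟧≡1 _ E.elements generic (λ y → trans (cong₂ E._*_
        (indicator-zero E charE (sum-relation x y) generic (⟦neg⟧ E charE (X (x E.+ y)) (X x ⊞ X y) generic
          (trans (⟦X⟧-generic (x E.+ y)) (sym (cong₂ E._+_ (⟦X⟧-generic x) (⟦X⟧-generic y))))))
        (indicator-zero E charE (product-relation x y) generic (⟦neg⟧ E charE (X (x E.* y)) (X x ⊠ X y) generic
          (trans (⟦X⟧-generic (x E.* y)) (sym (cong₂ E._*_ (⟦X⟧-generic x) (⟦X⟧-generic y)))))))
        (E.*-identityˡ _))))
      (indicator-zero E charE one-relation generic (⟦neg⟧ E charE (X E.1#) (const 1) generic (trans (⟦X⟧-generic E.1#) (sym (E.+-identityʳ E.1#))))))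
      (E.*-identityˡ _)

    -- The search through K^n cannot come back empty: an indicator that is zero throughout K^n would
    -- be zero at `generic` by `identity-transfer`.
    point : ∃ λ v → ¬ (K.⟦ homomorphism-indicator ⟧ v ≡ K.0#)
    point = Sum.[ (λ found → found) , (λ vanish → ⊥-elim (E.0≢1 (trans (sym (identity-transfer homomorphism-indicator vanish generic)) homomorphism-indicator-generic))) ]′
      (K.searchVec n (λ v → Sum.swap (toSum (K.⟦ homomorphism-indicator ⟧ v K.≟ K.0#))))

  homomorphism : Homomorphism E K
  homomorphism = record
    { φ   = λ x → K.⟦ X x ⟧ v
    ; φ-+ = λ x y → ⟦neg⟧⁻ K charK (X (x E.+ y)) (X x ⊞ X y) v (zero-of (sum-relation x y) (proj₁ (pair x y)))
    ; φ-* = λ x y → ⟦neg⟧⁻ K charK (X (x E.* y)) (X x ⊠ X y) v (zero-of (product-relation x y) (proj₂ (pair x y)))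
    ; φ-1 = trans (⟦neg⟧⁻ K charK (X E.1#) (const 1) v (zero-of one-relation (proj₂ outer))) (K.+-identityʳ K.1#)
    }
    where
    v = proj₁ point
    zero-of = λ g → indicator-nonzero K charK order-K g v
    rows : E.Carrier → Term n
    rows x = productᵗ (λ y → indicator (sum-relation x y) ⊠ indicator (product-relation x y)) E.elements
    outer = factors K charK (productᵗ rows E.elements) (indicator one-relation) v (proj₂ point)
    pair : ∀ x y → _
    pair x y = factors K charK (indicator (sum-relation x y)) (indicator (product-relation x y)) v
      (K.⟦product⟧≢0 _ E.elements v (K.⟦product⟧≢0 rows E.elements v (proj₁ outer) (E.elements-complete x)) (E.elements-complete y))

-- The polynomial F and its planarity

module DOSums (p n : ℕ) (K : FiniteField) where
  open FieldTheory K

  sumTo-cong : ∀ k {f g : ℕ → Carrier} → (∀ j → f j ≡ g j) → sumTo k f ≡ sumTo k g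
  sumTo-cong zero    eq = refl
  sumTo-cong (suc k) eq = cong₂ _+_ (sumTo-cong k eq) (eq k)

  sumTo-+ : ∀ k (f g : ℕ → Carrier) → sumTo k (λ j → f j + g j) ≡ sumTo k f + sumTo k g
  sumTo-+ zero    f g = sym (+-identityˡ 0#)
  sumTo-+ (suc k) f g = trans (cong (_+ (f k + g k)) (sumTo-+ k f g))
    (solve 4 (λ a b c d → a :+ b :+ (c :+ d) := a :+ c :+ (b :+ d)) refl (sumTo k f) (sumTo k g) (f k) (g k))

  sumTo-* : ∀ k c (f : ℕ → Carrier) → sumTo k (λ j → c * f j) ≡ c * sumTo k f
  sumTo-* zero    c f = sym (zeroʳ c)
  sumTo-* (suc k) c f = trans (cong (_+ c * f k) (sumTo-* k c f)) (sym (distribˡ c _ _))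

  δ : ℕ → ℕ → Carrier
  δ a b with a ℕ.≟ b
  ... | yes _ = 1#
  ... | no  _ = 0#

  δ-≢ : ∀ {a b} → ¬ (a ≡ b) → ∀ x → δ a b * x ≡ 0#
  δ-≢ {a} {b} a≢b x with a ℕ.≟ b
  ... | yes a≡b = contradiction a≡b a≢b
  ... | no  _   = zeroˡ x

  δ-≡ : ∀ a x → δ a a * x ≡ x
  δ-≡ a x with a ℕ.≟ a
  ... | yes _  = *-identityˡ x
  ... | no a≢a = contradiction refl a≢a

  sumTo-δ-≥ : ∀ {b} k (f : ℕ → Carrier) → k ℕ.≤ b → sumTo k (λ j → δ j b * f j) ≡ 0#
  sumTo-δ-≥ zero    f _   = refl
  sumTo-δ-≥ (suc k) f k<b = trans (cong₂ _+_ (sumTo-δ-≥ k f (ℕ.<⇒≤ k<b)) (δ-≢ (ℕ.<⇒≢ k<b) (f k))) (+-identityʳ 0#)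

  sumTo-δ : ∀ {b} k (f : ℕ → Carrier) → b ℕ.< k → sumTo k (λ j → δ j b * f j) ≡ f b
  sumTo-δ {b} (suc k) f (s≤s b≤k) with ℕ.m≤n⇒m<n∨m≡n b≤k
  ... | inj₁ b<k  = trans (cong₂ _+_ (sumTo-δ k f b<k) (δ-≢ (ℕ.<⇒≢ b<k ∘ sym) (f k))) (+-identityʳ (f b))
  ... | inj₂ refl = trans (cong₂ _+_ (sumTo-δ-≥ k f ℕ.≤-refl) (δ-≡ k (f k))) (+-identityˡ (f k))

  IsDO-+ : ∀ {F G} → IsDO p n K F → IsDO p n K G → IsDO p n K (λ x → F x + G x)
  IsDO-+ {F} {G} (α , F≡) (β , G≡) = (λ k j → α k j + β k j) , λ x → sym (begin
    sumTo n (λ j → sumTo (suc j) (λ k → (α k j + β k j) * mono x k j))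
      ≡⟨ sumTo-cong n (λ j → trans (sumTo-cong (suc j) (λ k → distribʳ (mono x k j) (α k j) (β k j))) (sumTo-+ (suc j) _ _)) ⟩
    sumTo n (λ j → sumTo (suc j) (λ k → α k j * mono x k j) + sumTo (suc j) (λ k → β k j * mono x k j))
      ≡⟨ sumTo-+ n _ _ ⟩
    sumTo n (λ j → sumTo (suc j) (λ k → α k j * mono x k j)) + sumTo n (λ j → sumTo (suc j) (λ k → β k j * mono x k j))
      ≡⟨ cong₂ _+_ (F≡ x) (G≡ x) ⟨
    F x + G x ∎)
    where
    open ≡-Reasoning
    mono : Carrier → ℕ → ℕ → Carrier
    mono x k j = x ^ ((p ℕ.^ j) ℕ.+ (p ℕ.^ k))

  IsDO-* : ∀ {F} c → IsDO p n K F → IsDO p n K (λ x → c * F x)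
  IsDO-* {F} c (α , F≡) = (λ k j → c * α k j) , λ x → sym (trans
    (sumTo-cong n (λ j → trans (sumTo-cong (suc j) (λ k → *-assoc c (α k j) _)) (sumTo-* (suc j) c _)))
    (trans (sumTo-* n c _) (cong (c *_) (sym (F≡ x)))))

  -- The larger exponent b is the outer index, because the inner index runs only up to the outer
  -- one. The two Kronecker deltas single out one summand.
  IsDO-monomial : ∀ {a b} → a ℕ.≤ b → b ℕ.< n → IsDO p n K (λ x → x ^ ((p ℕ.^ b) ℕ.+ (p ℕ.^ a)))
  IsDO-monomial {a} {b} a≤b b<n = (λ k j → δ j b * δ k a) , λ x → sym (trans
    (sumTo-cong n (λ j → trans (sumTo-cong (suc j) (λ k → *-assoc (δ j b) (δ k a) _)) (sumTo-* (suc j) (δ j b) _)))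
    (trans (sumTo-δ n _ b<n) (sumTo-δ (suc b) _ (s≤s a≤b))))

  IsDO-cong : ∀ {F G : Carrier → Carrier} → (∀ x → F x ≡ G x) → IsDO p n K G → IsDO p n K F
  IsDO-cong eq (α , G≡) = α , λ x → trans (eq x) (G≡ x)

-- The exponents are p^0 + p^0, p^m + p^0, p^(m+i) + p^i and p^(m+i) + p^(m+i), and i < m keeps m +
-- i below 2m.
polyF-isDO : ∀ p m i (K : FiniteField) → i ℕ.< m → IsDO p (2 ℕ.* m) K (polyF p m i K)
polyF-isDO p m i K i<m = IsDO-cong eq
  (IsDO-+ (IsDO-+ (IsDO-+ (IsDO-monomial ℕ.z≤n 0<2m) (IsDO-monomial ℕ.z≤n m<2m))
                  (IsDO-* (- 1#) (IsDO-monomial (ℕ.m≤n+m i m) m+i<2m)))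
          (IsDO-monomial ℕ.≤-refl m+i<2m))
  where
  open FieldTheory K
  open DOSums p (2 ℕ.* m) K
  m+i<2m : m ℕ.+ i ℕ.< 2 ℕ.* m
  m+i<2m = ℕ.+-monoʳ-< m (ℕ.<-≤-trans i<m (ℕ.m≤m+n m 0))
  m<2m : m ℕ.< 2 ℕ.* m
  m<2m = ℕ.≤-<-trans (ℕ.m≤m+n m i) m+i<2m
  0<2m : 0 ℕ.< 2 ℕ.* m
  0<2m = ℕ.≤-<-trans ℕ.z≤n m<2m
  q = p ℕ.^ m
  e₁ : (q ℕ.+ 1) ℕ.* (p ℕ.^ i) ≡ (p ℕ.^ (m ℕ.+ i)) ℕ.+ (p ℕ.^ i)
  e₁ = trans (ℕ.*-distribʳ-+ (p ℕ.^ i) q 1) (cong₂ ℕ._+_ (sym (ℕ.^-distribˡ-+-* p m i)) (ℕ.*-identityˡ _))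
  e₂ : 2 ℕ.* q ℕ.* (p ℕ.^ i) ≡ (p ℕ.^ (m ℕ.+ i)) ℕ.+ (p ℕ.^ (m ℕ.+ i))
  e₂ = trans (ℕ.*-assoc 2 q (p ℕ.^ i)) (trans (cong (2 ℕ.*_) (sym (ℕ.^-distribˡ-+-* p m i))) (cong (p ℕ.^ (m ℕ.+ i) ℕ.+_) (ℕ.+-identityʳ _)))
  eq : ∀ x → polyF p m i K x ≡ (x ^ 2) + (x ^ (q ℕ.+ 1)) + - 1# * (x ^ ((p ℕ.^ (m ℕ.+ i)) ℕ.+ (p ℕ.^ i)))
                               + (x ^ ((p ℕ.^ (m ℕ.+ i)) ℕ.+ (p ℕ.^ (m ℕ.+ i))))
  eq x = trans (cong₂ (λ c d → (x ^ 2) + (x ^ (q ℕ.+ 1)) + - (x ^ c) + (x ^ d)) e₁ e₂)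
    (solve 4 (λ a b c d → a :+ b :+ :- c :+ d := a :+ b :+ (:- con (pos 1)) :* c :+ d) refl
      (x ^ 2) (x ^ (q ℕ.+ 1)) (x ^ ((p ℕ.^ (m ℕ.+ i)) ℕ.+ (p ℕ.^ i))) (x ^ ((p ℕ.^ (m ℕ.+ i)) ℕ.+ (p ℕ.^ (m ℕ.+ i)))))

-- Even and odd elements and the product of the presemifield

module QuadraticExtension (p m i : ℕ) (p-prime : Prime p) (2∤p : ¬ (2 ∣ p)) (K : FiniteField)
  (order-K : FiniteField.order K ≡ (p ℕ.^ m) ℕ.^ 2) where

  open FieldTheory K

  q = p ℕ.^ m

  p×1ᴷ : p × 1# ≡ 0#
  p×1ᴷ = p×1≡0 (m ℕ.* 2) (trans order-K (ℕ.^-*-assoc p m 2))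

  open Characteristic K p p-prime p×1ᴷ

  x+x≡0⇒x≡0 : ∀ {x} → x + x ≡ 0# → x ≡ 0#
  x+x≡0⇒x≡0 = x+x≡0 2∤p

  bar σ : Carrier → Carrier
  bar x = x ^ q
  σ x   = x ^ (p ℕ.^ i)

  bar-+ : ∀ x y → bar (x + y) ≡ bar x + bar y
  bar-+ = frobenius^-+ m

  σ-+ : ∀ x y → σ (x + y) ≡ σ x + σ y
  σ-+ = frobenius^-+ i

  bar-* : ∀ x y → bar (x * y) ≡ bar x * bar y
  bar-* x y = ^-distrib-* x y q

  σ-* : ∀ x y → σ (x * y) ≡ σ x * σ y
  σ-* x y = ^-distrib-* x y (p ℕ.^ i)

  open Additivity bar-+ public using () renaming (f-0 to bar-0; f-neg to bar-neg)
  open Additivity σ-+ public using () renaming (f-0 to σ-0; f-neg to σ-neg)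

  bar-σ : ∀ x → bar (σ x) ≡ σ (bar x)
  bar-σ x = ^-comm x (p ℕ.^ i) q

  bar-bar : ∀ x → bar (bar x) ≡ x
  bar-bar x = trans (sym (^-* x q q)) (trans (cong (x ^_) (trans (cong (q ℕ.*_) (sym (ℕ.*-identityʳ q))) (sym order-K))) (x^order x))

  Even Odd : Carrier → Set
  Even x = bar x ≡ x
  Odd  x = bar x ≡ - x

  even-+ : ∀ {x y} → Even x → Even y → Even (x + y)
  even-+ {x} {y} ex ey = trans (bar-+ x y) (cong₂ _+_ ex ey)

  odd-+ : ∀ {x y} → Odd x → Odd y → Odd (x + y)
  odd-+ {x} {y} ox oy = trans (bar-+ x y) (trans (cong₂ _+_ ox oy) (⁻¹-∙-comm x y))

  odd-neg : ∀ {x} → Odd x → Odd (- x)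
  odd-neg {x} ox = trans (bar-neg x) (cong -_ ox)

  even*even : ∀ {x y} → Even x → Even y → Even (x * y)
  even*even {x} {y} ex ey = trans (bar-* x y) (cong₂ _*_ ex ey)

  even*odd : ∀ {x y} → Even x → Odd y → Odd (x * y)
  even*odd {x} {y} ex oy = trans (bar-* x y) (trans (cong₂ _*_ ex oy) (sym (-‿distribʳ-* x y)))

  odd*even : ∀ {x y} → Odd x → Even y → Odd (x * y)
  odd*even {x} {y} ox ey = trans (bar-* x y) (trans (cong₂ _*_ ox ey) (sym (-‿distribˡ-* x y)))

  odd*odd : ∀ {x y} → Odd x → Odd y → Even (x * y)
  odd*odd {x} {y} ox oy = trans (bar-* x y) (trans (cong₂ _*_ ox oy) (solve 2 (λ x y → :- x :* :- y := x :* y) refl x y))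

  even-σ : ∀ {x} → Even x → Even (σ x)
  even-σ {x} ex = trans (bar-σ x) (cong σ ex)

  odd-σ : ∀ {x} → Odd x → Odd (σ x)
  odd-σ {x} ox = trans (bar-σ x) (trans (cong σ ox) (σ-neg x))

  even∧odd⇒0 : ∀ {x} → Even x → Odd x → x ≡ 0#
  even∧odd⇒0 {x} ex ox = x+x≡0⇒x≡0 (trans (cong (x +_) (trans (sym ex) ox)) (-‿inverseʳ x))

  -- Here e = -o is even and odd at once.
  even+odd≡0 : ∀ {e o} → Even e → Odd o → e + o ≡ 0# → e ≡ 0# ∧ o ≡ 0#
  even+odd≡0 {e} {o} ev od e+o≡0 = e≡0 , trans (sym (+-identityˡ o)) (trans (cong (_+ o) (sym e≡0)) e+o≡0)
    where
    e≡-o : e ≡ - o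
    e≡-o = x-y≡0 (trans (cong (e +_) (-‿involutive o)) e+o≡0)
    e≡0 : e ≡ 0#
    e≡0 = even∧odd⇒0 ev (trans (cong bar e≡-o) (trans (bar-neg o) (trans (cong -_ od) (cong -_ (sym e≡-o)))))

  decompose : ∀ x → ∃ λ u → ∃ λ v → Even u ∧ Odd v ∧ x ≡ u + v
  decompose x = half * (x + bar x) , half * (x + - bar x) , even*even half-even sum-even , even*odd half-even difference-odd , x≡
    where
    open ≡-Reasoning
    two≢0 : ¬ (1# + 1# ≡ 0#)
    two≢0 eq = 0≢1 (sym (x+x≡0⇒x≡0 eq))
    half = proj₁ (inverse (1# + 1#) two≢0)
    two*half : (1# + 1#) * half ≡ 1#
    two*half = proj₂ (inverse (1# + 1#) two≢0)
    even-1 : Even 1#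
    even-1 = 1^ q
    half-even : Even half
    half-even = cancelˡ two≢0 (begin
      (1# + 1#) * bar half        ≡⟨ cong (_* bar half) (even-+ even-1 even-1) ⟨
      bar (1# + 1#) * bar half    ≡⟨ bar-* (1# + 1#) half ⟨
      bar ((1# + 1#) * half)      ≡⟨ cong bar two*half ⟩
      bar 1#                   ≡⟨ even-1 ⟩
      1#                       ≡⟨ two*half ⟨
      (1# + 1#) * half            ∎)
    sum-even : Even (x + bar x)
    sum-even = trans (bar-+ x (bar x)) (trans (cong (bar x +_) (bar-bar x)) (+-comm _ _))
    difference-odd : Odd (x + - bar x)
    difference-odd = trans (bar-+ x (- bar x)) (trans (cong (bar x +_) (trans (bar-neg (bar x)) (cong -_ (bar-bar x))))
      (solve 2 (λ x y → y :- x := :- (x :- y)) refl x (bar x)))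
    x≡ : x ≡ half * (x + bar x) + half * (x + - bar x)
    x≡ = begin
      x                                        ≡⟨ *-identityˡ x ⟨
      1# * x                                   ≡⟨ cong (_* x) two*half ⟨
      (1# + 1#) * half * x                        ≡⟨ solve 3 (λ x y h → (con (pos 1) :+ con (pos 1)) :* h :* x := h :* (x :+ y) :+ h :* (x :- y)) refl x (bar x) half ⟩
      half * (x + bar x) + half * (x + - bar x)      ∎

  star : Carrier → Carrier → Carrier
  star = starF K (polyF p m i K)

  polyF≡ : ∀ x → polyF p m i K x ≡ x * x + x * bar x + - σ (x * bar x) + σ (bar x * bar x)
  polyF≡ x = cong₂ _+_ (cong₂ (λ a b → a + - b) (cong₂ _+_ (cong (x *_) (*-identityʳ x)) q+1) (trans (^-* x (q ℕ.+ 1) _) (cong σ q+1)))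
                       (trans (^-* x (2 ℕ.* q) _) (cong σ (trans (^-* x 2 q) (trans (cong (λ z → bar (x * z)) (*-identityʳ x)) (bar-* x x)))))
    where
    q+1 : x ^ (q ℕ.+ 1) ≡ x * bar x
    q+1 = trans (^-+ x q 1) (trans (cong (bar x *_) (*-identityʳ x)) (*-comm _ _))

  -- The polarisation of F written out: x² contributes 2xy, x x̄ contributes x ȳ + x̄ y, and x̄²
  -- contributes 2 x̄ ȳ, the last two also under σ.
  bilinear : Carrier → Carrier → Carrier
  bilinear x y = x * y + x * y + (x * bar y + bar x * y) + - σ (x * bar y + bar x * y) + (σ (bar x * bar y) + σ (bar x * bar y))

  polyF-+ : ∀ x y → polyF p m i K (x + y) ≡ bilinear x y + polyF p m i K x + polyF p m i K y
  polyF-+ x y = begin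
    polyF p m i K (x + y)
      ≡⟨ polyF≡ (x + y) ⟩
    (x + y) * (x + y) + (x + y) * bar (x + y) + - σ ((x + y) * bar (x + y)) + σ (bar (x + y) * bar (x + y))
      ≡⟨ cong (λ z → (x + y) * (x + y) + (x + y) * z + - σ ((x + y) * z) + σ (z * z)) (bar-+ x y) ⟩
    (x + y) * (x + y) + (x + y) * (X + Y) + - σ ((x + y) * (X + Y)) + σ ((X + Y) * (X + Y))
      ≡⟨ cong₂ (λ a b → (x + y) * (x + y) + (x + y) * (X + Y) + - a + b) σ₁ σ₂ ⟩
    (x + y) * (x + y) + (x + y) * (X + Y) + - (σ (x * X) + σ t + σ (y * Y)) + (σ (X * X) + (σ (X * Y) + σ (X * Y)) + σ (Y * Y))
      -- Once σ is distributed over sums, its six values enter as independent unknowns.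
      ≡⟨ solve 10 (λ x y X Y a b c d e f →
           (x :+ y) :* (x :+ y) :+ (x :+ y) :* (X :+ Y) :+ :- (a :+ b :+ c) :+ (d :+ (e :+ e) :+ f) :=
           x :* y :+ x :* y :+ (x :* Y :+ X :* y) :+ :- b :+ (e :+ e) :+ (x :* x :+ x :* X :+ :- a :+ d) :+ (y :* y :+ y :* Y :+ :- c :+ f))
           refl x y X Y (σ (x * X)) (σ t) (σ (y * Y)) (σ (X * X)) (σ (X * Y)) (σ (Y * Y)) ⟩
    bilinear x y + (x * x + x * X + - σ (x * X) + σ (X * X)) + (y * y + y * Y + - σ (y * Y) + σ (Y * Y))
      ≡⟨ cong₂ (λ a b → bilinear x y + a + b) (polyF≡ x) (polyF≡ y) ⟨
    bilinear x y + polyF p m i K x + polyF p m i K y ∎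
    where
    open ≡-Reasoning
    X = bar x
    Y = bar y
    t = x * Y + X * y
    σ₃ : ∀ a b c → σ (a + b + c) ≡ σ a + σ b + σ c
    σ₃ a b c = trans (σ-+ (a + b) c) (cong (_+ σ c) (σ-+ a b))
    σ₁ : σ ((x + y) * (X + Y)) ≡ σ (x * X) + σ t + σ (y * Y)
    σ₁ = trans (cong σ (solve 4 (λ x y X Y → (x :+ y) :* (X :+ Y) := x :* X :+ (x :* Y :+ X :* y) :+ y :* Y) refl x y X Y)) (σ₃ _ _ _)
    σ₂ : σ ((X + Y) * (X + Y)) ≡ σ (X * X) + (σ (X * Y) + σ (X * Y)) + σ (Y * Y)
    σ₂ = trans (cong σ (solve 2 (λ X Y → (X :+ Y) :* (X :+ Y) := X :* X :+ (X :* Y :+ X :* Y) :+ Y :* Y) refl X Y))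
               (trans (σ₃ _ _ _) (cong (λ z → σ (X * X) + z + σ (Y * Y)) (σ-+ _ _)))

  star≡bilinear : ∀ x y → star x y ≡ bilinear x y
  star≡bilinear x y = trans (cong (λ z → z + - polyF p m i K x + - polyF p m i K y) (polyF-+ x y))
    (solve 3 (λ b f g → b :+ f :+ g :+ :- f :+ :- g := b) refl (bilinear x y) (polyF p m i K x) (polyF p m i K y))

  -- This is 4 e + 2 (s - σ(s)). The multiples are nested sums, so that `x+x≡0⇒x≡0` can strip one
  -- doubling at a time.
  pack : Carrier → Carrier → Carrier
  pack e s = e + e + (e + e) + (s + - σ s + (s + - σ s))

  -- Put r = u w, k = v z and s = u z + v w. Conjugation negates v and z, so x ȳ + x̄ y = 2 (r - k)
  -- and x̄ ȳ = r + k - s. In the total the terms in k and in σ(r) cancel, while those in r and in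
  -- σ(k) double.
  bilinear≡pack : ∀ {u v w z} → Even u → Odd v → Even w → Odd z →
                  bilinear (u + v) (w + z) ≡ pack (u * w + σ (v * z)) (u * z + v * w)
  bilinear≡pack {u} {v} {w} {z} eu ov ew oz = begin
    bilinear (u + v) (w + z)
      ≡⟨ cong₂ form (trans (bar-+ u v) (cong₂ _+_ eu ov)) (trans (bar-+ w z) (cong₂ _+_ ew oz)) ⟩
    form (u + - v) (w + - z)
      ≡⟨ cong₂ (λ a b → x * y + x * y + t + - a + (b + b)) σt σb ⟩
    x * y + x * y + t + - (σ r + σ r + - (σ k + σ k)) + (σ r + σ k + - σ s + (σ r + σ k + - σ s))
      ≡⟨ solve 7 (λ u v w z σr σk σs →
           (u :+ v) :* (w :+ z) :+ (u :+ v) :* (w :+ z) :+ ((u :+ v) :* (w :+ :- z) :+ (u :+ :- v) :* (w :+ z))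
             :+ :- (σr :+ σr :+ :- (σk :+ σk)) :+ (σr :+ σk :+ :- σs :+ (σr :+ σk :+ :- σs)) :=
           u :* w :+ σk :+ (u :* w :+ σk) :+ (u :* w :+ σk :+ (u :* w :+ σk))
             :+ (u :* z :+ v :* w :+ :- σs :+ (u :* z :+ v :* w :+ :- σs)))
           refl u v w z (σ r) (σ k) (σ s) ⟩
    pack (r + σ k) s ∎
    where
    open ≡-Reasoning
    x = u + v
    y = w + z
    r = u * w
    k = v * z
    s = u * z + v * w
    form : Carrier → Carrier → Carrier
    form X Y = x * y + x * y + (x * Y + X * y) + - σ (x * Y + X * y) + (σ (X * Y) + σ (X * Y))
    t = x * (w + - z) + (u + - v) * y
    σt : σ t ≡ σ r + σ r + - (σ k + σ k)
    σt = begin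
      σ t                                ≡⟨ cong σ (solve 4 (λ u v w z → (u :+ v) :* (w :+ :- z) :+ (u :+ :- v) :* (w :+ z) := u :* w :+ u :* w :+ :- (v :* z :+ v :* z)) refl u v w z) ⟩
      σ (r + r + - (k + k))              ≡⟨ σ-+ (r + r) (- (k + k)) ⟩
      σ (r + r) + σ (- (k + k))          ≡⟨ cong₂ _+_ (σ-+ r r) (trans (σ-neg (k + k)) (cong -_ (σ-+ k k))) ⟩
      σ r + σ r + - (σ k + σ k)          ∎
    σb : σ ((u + - v) * (w + - z)) ≡ σ r + σ k + - σ s
    σb = begin
      σ ((u + - v) * (w + - z))          ≡⟨ cong σ (solve 4 (λ u v w z → (u :+ :- v) :* (w :+ :- z) := u :* w :+ v :* z :+ :- (u :* z :+ v :* w)) refl u v w z) ⟩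
      σ (r + k + - s)                    ≡⟨ σ-+ (r + k) (- s) ⟩
      σ (r + k) + σ (- s)                ≡⟨ cong₂ _+_ (σ-+ r k) (σ-neg s) ⟩
      σ r + σ k + - σ s                  ∎

  module _ (gcd≡ : gcd i m ≡ gcd i (2 ℕ.* m)) where

    fixed-multiple : ∀ {s} a → s ^ (p ℕ.^ a) ≡ s → ∀ k → s ^ (p ℕ.^ (k ℕ.* a)) ≡ s
    fixed-multiple {s} a fixed zero    = *-identityʳ s
    fixed-multiple {s} a fixed (suc k) = trans (cong (s ^_) (ℕ.^-distribˡ-+-* p a (k ℕ.* a)))
      (trans (^-* s (p ℕ.^ a) _) (trans (cong (_^ (p ℕ.^ (k ℕ.* a))) fixed) (fixed-multiple a fixed k)))

    -- The p^(yb)-th power fixes s, so applying it to s^(p^d) changes nothing and raises the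
    -- exponent to p^(xa), which fixes s too.
    fixed-difference : ∀ {s} d x y a b → d ℕ.+ y ℕ.* b ≡ x ℕ.* a → s ^ (p ℕ.^ a) ≡ s → s ^ (p ℕ.^ b) ≡ s → s ^ (p ℕ.^ d) ≡ s
    fixed-difference {s} d x y a b eq fa fb = begin
      s ^ (p ℕ.^ d)                                  ≡⟨ cong (_^ (p ℕ.^ d)) (fixed-multiple b fb y) ⟨
      (s ^ (p ℕ.^ (y ℕ.* b))) ^ (p ℕ.^ d)            ≡⟨ ^-comm s (p ℕ.^ (y ℕ.* b)) (p ℕ.^ d) ⟩
      (s ^ (p ℕ.^ d)) ^ (p ℕ.^ (y ℕ.* b))            ≡⟨ ^-* s (p ℕ.^ d) _ ⟨
      s ^ (p ℕ.^ d ℕ.* p ℕ.^ (y ℕ.* b))              ≡⟨ cong (s ^_) (ℕ.^-distribˡ-+-* p d (y ℕ.* b)) ⟨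
      s ^ (p ℕ.^ (d ℕ.+ y ℕ.* b))                    ≡⟨ cong (λ e → s ^ (p ℕ.^ e)) eq ⟩
      s ^ (p ℕ.^ (x ℕ.* a))                          ≡⟨ fixed-multiple a fa x ⟩
      s                                              ∎
      where open ≡-Reasoning

    fixed-gcd : ∀ {s} a b → s ^ (p ℕ.^ a) ≡ s → s ^ (p ℕ.^ b) ≡ s → s ^ (p ℕ.^ gcd a b) ≡ s
    fixed-gcd a b fa fb with Bézout.identity (gcd-GCD a b)
    ... | Bézout.+- x y eq = fixed-difference (gcd a b) x y a b eq fa fb
    ... | Bézout.-+ x y eq = fixed-difference (gcd a b) y x b a eq fb fa

    σ-fixed-odd : ∀ {s} → Odd s → σ s ≡ s → s ≡ 0#
    σ-fixed-odd {s} os σs≡s with gcd[m,n]∣n i m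
    ... | divides k m≡k*gcd = even∧odd⇒0 (trans (cong (λ e → s ^ (p ℕ.^ e)) m≡k*gcd) (fixed-multiple (gcd i m) fixed k)) os
      where
      fixed-2m : s ^ (p ℕ.^ (2 ℕ.* m)) ≡ s
      fixed-2m = trans (cong (s ^_) (ℕ.^-distribˡ-+-* p m (m ℕ.+ 0)))
        (trans (^-* s q _) (trans (cong (λ e → bar s ^ (p ℕ.^ e)) (ℕ.+-identityʳ m)) (bar-bar s)))
      fixed : s ^ (p ℕ.^ gcd i m) ≡ s
      -- The hypothesis replaces gcd(i,2m) by gcd(i,m), a divisor of m.
      fixed = trans (cong (λ d → s ^ (p ℕ.^ d)) gcd≡) (fixed-gcd i (2 ℕ.* m) σs≡s fixed-2m)

    pack≡0 : ∀ {e s} → Even e → Odd s → pack e s ≡ 0# → e ≡ 0# ∧ s ≡ 0#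
    pack≡0 {e} {s} ee os eq =
      let quadruple≡0 , double≡0 = even+odd≡0 (even-+ (even-+ ee ee) (even-+ ee ee)) (odd-+ od od) eq
      in x+x≡0⇒x≡0 (x+x≡0⇒x≡0 quadruple≡0) , σ-fixed-odd os (sym (x-y≡0 (x+x≡0⇒x≡0 double≡0)))
      where
      od : Odd (s + - σ s)
      od = odd-+ os (odd-neg (odd-σ os))

    -- With r = vz the two equations force σ(r)/r = (w/z)², whereas σ(r)/r = (r^((p^i−1)/2))² is the
    -- square of an even element and w/z is odd.
    no-zero-divisors : ∀ {u v w z} → Even u → Odd v → Even w → Odd z → ¬ (w + z ≡ 0#) →
                       u * w + σ (v * z) ≡ 0# → u * z + v * w ≡ 0# → u ≡ 0# ∧ v ≡ 0#
    no-zero-divisors {u} {v} {w} {z} eu ov ew oz w+z≢0 E S with v ≟ 0# | z ≟ 0#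
    ... | yes refl | yes refl = Sum.[ (λ u≡0 → u≡0 , refl) , (λ w≡0 → contradiction (trans (+-identityʳ w) w≡0) w+z≢0) ]′ (x*y≡0 uw≡0)
      where
      uw≡0 : u * w ≡ 0#
      uw≡0 = trans (sym (trans (cong (u * w +_) (trans (cong σ (zeroʳ 0#)) σ-0)) (+-identityʳ _))) E
    ... | yes refl | no z≢0   = Sum.[ (λ u≡0 → u≡0 , refl) , (λ z≡0 → contradiction z≡0 z≢0) ]′ (x*y≡0 uz≡0)
      where
      uz≡0 : u * z ≡ 0#
      uz≡0 = trans (sym (trans (cong (u * z +_) (zeroˡ w)) (+-identityʳ _))) S
    ... | no v≢0   | yes refl = contradiction (trans (+-identityʳ w) w≡0) w+z≢0
      where
      vw≡0 : v * w ≡ 0#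
      vw≡0 = trans (sym (trans (cong (_+ v * w) (zeroʳ u)) (+-identityˡ _))) S
      w≡0 : w ≡ 0#
      w≡0 = Sum.[ (λ v≡0 → contradiction v≡0 v≢0) , (λ w≡0 → w≡0) ]′ (x*y≡0 vw≡0)
    ... | no v≢0   | no z≢0   = ⊥-elim (*-nonzero g≢0 z≢0 gz≡0)
      where
      open ≡-Reasoning
      h-odd = odd-^ (odd 2∤p) i
      h = proj₁ h-odd
      r = v * z
      g = r ^ h
      σr≡ : σ r ≡ r * (g * g)
      σr≡ = trans (cong (r ^_) (proj₂ h-odd)) (cong (r *_) (trans (^-* r h 2) (cong (g *_) (*-identityʳ g))))
      g≢0 : ¬ (g ≡ 0#)
      g≢0 g≡0 = *-nonzero v≢0 z≢0 (x^n≡0 h g≡0)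
      g-even : Even g
      g-even = trans (^-comm r h q) (cong (_^ h) (odd*odd ov oz))
      -- Now σ(r) = r g², so z times the first equation minus w times the second eliminates u and
      -- leaves v (g z)² = v w².
      squares : g * z * (g * z) ≡ w * w
      squares = cancelˡ v≢0 (begin
        v * (g * z * (g * z))
          ≡⟨ solve 5 (λ u v w z g → v :* (g :* z :* (g :* z)) := (u :* w :+ v :* z :* (g :* g)) :* z :+ v :* (w :* w) :- (u :* z :+ v :* w) :* w) refl u v w z g ⟩
        (u * w + r * (g * g)) * z + v * (w * w) + - ((u * z + v * w) * w)
          ≡⟨ cong₂ (λ a b → a * z + v * (w * w) + - (b * w)) (trans (cong (u * w +_) (sym σr≡)) E) S ⟩
        0# * z + v * (w * w) + - (0# * w)
          ≡⟨ solve 3 (λ v w z → con (pos 0) :* z :+ v :* (w :* w) :- con (pos 0) :* w := v :* (w :* w)) refl v w z ⟩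
        v * (w * w) ∎)
      gz-odd : Odd (g * z)
      gz-odd = even*odd g-even oz
      gz≡0 : g * z ≡ 0#
      -- Equal to w or -w, the odd element g z is also even.
      gz≡0 = even∧odd⇒0
        (Sum.[ (λ eq → subst Even (sym eq) ew) , (λ eq → subst Even (sym eq) (trans (bar-neg w) (cong -_ ew))) ]′ (x*x≡y*y squares)) gz-odd

    bilinear≡0 : ∀ {x y} → ¬ (y ≡ 0#) → bilinear x y ≡ 0# → x ≡ 0#
    bilinear≡0 {x} {y} y≢0 eq =
      let u , v , eu , ov , x≡ = decompose x
          w , z , ew , oz , y≡ = decompose y
          e≡0 , s≡0 = pack≡0 (even-+ (even*even eu ew) (even-σ (odd*odd ov oz))) (odd-+ (even*odd eu oz) (odd*even ov ew))
                        (trans (sym (bilinear≡pack eu ov ew oz)) (trans (sym (cong₂ bilinear x≡ y≡)) eq))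
          u≡0 , v≡0 = no-zero-divisors eu ov ew oz (λ w+z≡0 → y≢0 (trans y≡ w+z≡0)) e≡0 s≡0
      in trans x≡ (trans (cong₂ _+_ u≡0 v≡0) (+-identityʳ 0#))

    bilinear-+ˡ : ∀ x y z → bilinear (x + y) z ≡ bilinear x z + bilinear y z
    bilinear-+ˡ x y z = trans (cong form (bar-+ x y)) (trans (cong₂ (λ a b → (x + y) * z + (x + y) * z + ((x + y) * Z + (X + Y) * z) + - a + (b + b)) σ₁ σ₂)
      (solve 10 (λ x y z X Y Z a b c d →
         (x :+ y) :* z :+ (x :+ y) :* z :+ ((x :+ y) :* Z :+ (X :+ Y) :* z) :+ :- (a :+ b) :+ (c :+ d :+ (c :+ d)) :=
         x :* z :+ x :* z :+ (x :* Z :+ X :* z) :+ :- a :+ (c :+ c) :+ (y :* z :+ y :* z :+ (y :* Z :+ Y :* z) :+ :- b :+ (d :+ d)))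
         refl x y z X Y Z (σ (x * Z + X * z)) (σ (y * Z + Y * z)) (σ (X * Z)) (σ (Y * Z))))
      where
      X = bar x
      Y = bar y
      Z = bar z
      form : Carrier → Carrier
      form B = (x + y) * z + (x + y) * z + ((x + y) * Z + B * z) + - σ ((x + y) * Z + B * z) + (σ (B * Z) + σ (B * Z))
      σ₁ : σ ((x + y) * Z + (X + Y) * z) ≡ σ (x * Z + X * z) + σ (y * Z + Y * z)
      σ₁ = trans (cong σ (solve 6 (λ x y z X Y Z → (x :+ y) :* Z :+ (X :+ Y) :* z := x :* Z :+ X :* z :+ (y :* Z :+ Y :* z)) refl x y z X Y Z)) (σ-+ _ _)
      σ₂ : σ ((X + Y) * Z) ≡ σ (X * Z) + σ (Y * Z)
      σ₂ = trans (cong σ (distribʳ Z X Y)) (σ-+ _ _)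

    -- The difference map is x ↦ `bilinear x a` + F(a). By additivity in x, equal values at x and y
    -- give `bilinear (x − y) a` = 0, hence x = y; finiteness turns injectivity into bijectivity.
    polyF-planar : Planar K (polyF p m i K)
    polyF-planar a a≢0 = injective⇒bijective enumerated enumerated _ λ {x} {y} → injective x y
      where
      open ≡-Reasoning
      F = polyF p m i K
      difference : ∀ x → F (x + a) + - F x ≡ bilinear x a + F a
      difference x = trans (cong (_+ - F x) (polyF-+ x a)) (solve 3 (λ b f g → b :+ f :+ g :+ :- f := b :+ g) refl (bilinear x a) (F x) (F a))
      injective : ∀ x y → F (x + a) + - F x ≡ F (y + a) + - F y → x ≡ y
      injective x y eq = x-y≡0 (bilinear≡0 a≢0 (+-cancelˡ (bilinear y a) (begin
        bilinear y a + bilinear (x + - y) a       ≡⟨ bilinear-+ˡ y (x + - y) a ⟨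
        bilinear (y + (x + - y)) a                ≡⟨ cong (λ z → bilinear z a) (solve 2 (λ x y → y :+ (x :- y) := x) refl x y) ⟩
        bilinear x a                              ≡⟨ +-cancelˡ (F a) (trans (+-comm _ _) (trans (sym (difference x)) (trans eq (trans (difference y) (+-comm _ _))))) ⟩
        bilinear y a                              ≡⟨ +-identityʳ _ ⟨
        bilinear y a + 0#                         ∎)))

-- Isotopism with the Dickson semifield

module Homomorphisms (E K : FiniteField) (hom : Homomorphism E K) where
  private
    module E = FieldTheory E
    module K = FieldTheory K
  open Homomorphism hom

  φ-0 : φ E.0# ≡ K.0#
  φ-0 = sym (K.+-cancelˡ (φ E.0#) (trans (K.+-identityʳ _) (trans (sym (cong φ (E.+-identityʳ E.0#))) (φ-+ E.0# E.0#))))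

  φ-neg : ∀ x → φ (E.- x) ≡ K.- φ x
  φ-neg x = K.+-cancelˡ (φ x) (trans (sym (φ-+ x (E.- x))) (trans (cong φ (E.-‿inverseʳ x)) (trans φ-0 (sym (K.-‿inverseʳ (φ x))))))

  φ-^ : ∀ x n → φ (x E.^ n) ≡ φ x K.^ n
  φ-^ x zero    = φ-1
  φ-^ x (suc n) = trans (φ-* x (x E.^ n)) (cong (φ x K.*_) (φ-^ x n))

  φ≡0 : ∀ {x} → φ x ≡ K.0# → x ≡ E.0#
  φ≡0 {x} φx≡0 = decidable-stable (x E.≟ E.0#) λ x≢0 → let x⁻¹ , inv = E.inverse x x≢0 in K.0≢1 (begin
    K.0#                  ≡⟨ K.zeroˡ (φ x⁻¹) ⟨
    K.0# K.* φ x⁻¹        ≡⟨ cong (K._* φ x⁻¹) φx≡0 ⟨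
    φ x K.* φ x⁻¹         ≡⟨ φ-* x x⁻¹ ⟨
    φ (x E.* x⁻¹)         ≡⟨ cong φ inv ⟩
    φ E.1#                ≡⟨ φ-1 ⟩
    K.1#                  ∎)
    where open ≡-Reasoning

-- The natural maps go from E × E to K, whereas an isotopism is asked for in the other direction. A
-- trivial kernel and |K| = |E|² make such a map invertible.
module AdditiveInverse (E K : FiniteField) (order≡ : FiniteField.order K ≡ FiniteField.order E ℕ.* FiniteField.order E)
  (f : FiniteField.Carrier E ∧ FiniteField.Carrier E → FiniteField.Carrier K)
  (f-+ : ∀ x y → f (_⊕_ {E} x y) ≡ FiniteField._+_ K (f x) (f y))
  (f≡0 : ∀ a b → f (a , b) ≡ FiniteField.0# K → a ≡ FiniteField.0# E ∧ b ≡ FiniteField.0# E)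
  where
  private
    module E = FieldTheory E
    module K = FieldTheory K

  f-injective : Injective _≡_ _≡_ f
  f-injective {a , b} {c , d} eq = cong₂ _,_ (E.x-y≡0 (proj₁ kernel)) (E.x-y≡0 (proj₂ kernel))
    where
    x+[-x+y]≡y : ∀ x y → x E.+ (y E.+ E.- x) ≡ y
    x+[-x+y]≡y x y = E.solve 2 (λ x y → x E.:+ (y E.:- x) E.:= y) refl x y
    kernel : a E.+ E.- c ≡ E.0# ∧ b E.+ E.- d ≡ E.0#
    kernel = f≡0 _ _ (K.+-cancelˡ (f (c , d)) (trans (sym (f-+ _ _))
      (trans (cong f (cong₂ _,_ (x+[-x+y]≡y c a) (x+[-x+y]≡y d b))) (trans eq (sym (K.+-identityʳ _))))))

  private
    f-bijective : Bijective _≡_ _≡_ f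
    f-bijective = injective⇒bijective (Enumerated-× E.enumerated E.enumerated) (subst (Enumerated K.Carrier) order≡ K.enumerated) f f-injective

  -- The preimage comes from a finite search, which is kept from unfolding; afterwards only its
  -- defining equation is used.
  abstract
    f⁻¹ : K.Carrier → E.Carrier ∧ E.Carrier
    f⁻¹ x = proj₁ (proj₂ f-bijective x)

    f-f⁻¹ : ∀ x → f (f⁻¹ x) ≡ x
    f-f⁻¹ x = proj₂ (proj₂ f-bijective x) refl

  f⁻¹-f : ∀ {x y} → x ≡ f y → f⁻¹ x ≡ y
  f⁻¹-f {x} x≡fy = f-injective (trans (f-f⁻¹ x) x≡fy)

  f⁻¹-iso : AdditiveIso K E f⁻¹
  f⁻¹-iso = (λ x y → f⁻¹-f (sym (trans (f-+ (f⁻¹ x) (f⁻¹ y)) (cong₂ K._+_ (f-f⁻¹ x) (f-f⁻¹ y)))))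
          , (λ {x} {y} eq → trans (sym (f-f⁻¹ x)) (trans (cong f eq) (f-f⁻¹ y)))
          , (λ y → f y , f⁻¹-f)

module Isotopism (p m i : ℕ) (p-prime : Prime p) (2∤p : ¬ (2 ∣ p)) (i<m : i ℕ.< m)
  (gcd≡ : gcd i m ≡ gcd i (2 ℕ.* m))
  (K : FiniteField) (order-K : FiniteField.order K ≡ (p ℕ.^ m) ℕ.^ 2)
  (E : FiniteField) (order-E : FiniteField.order E ≡ p ℕ.^ m)
  (α : FiniteField.Carrier E) (α-nonsquare : ¬ FiniteField.IsSquare E α) where

  open FieldTheory K
  open QuadraticExtension p m i p-prime 2∤p K order-K
  private
    module E where
      open FieldTheory E public
      open Polynomials E public using (euler)

    p×1ᴱ : p E.× E.1# ≡ E.0#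
    p×1ᴱ = E.p×1≡0 m order-E

  order-K≥2 : ∃ λ k → order ≡ 2 ℕ.+ k
  order-K≥2 = go refl
    where
    go : ∀ {n} → order ≡ n → ∃ λ k → n ≡ 2 ℕ.+ k
    go {0}           eq = contradiction (trans (sym order≡1+nonzeros) eq) λ ()
    go {1}           eq = contradiction eq (Polynomials.order≢1 K)
    go {suc (suc k)} eq = k , refl

  x^q≡x : ∀ x → x E.^ q ≡ x
  x^q≡x x = trans (cong (x E.^_) (sym order-E)) (E.x^order x)

  hom : Homomorphism E K
  hom = go refl
    where
    k = proj₁ order-K≥2
    -- Since |K| = q², this power is the q-th power taken twice.
    fixed : ∀ x → x E.^ (2 ℕ.+ k) ≡ x
    fixed x = trans (cong (x E.^_) (trans (sym (proj₂ order-K≥2)) (trans order-K (cong (q ℕ.*_) (ℕ.*-identityʳ q)))))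
      (trans (E.^-* x q q) (trans (cong (E._^ q) (x^q≡x x)) (x^q≡x x)))
    -- Both fields have characteristic p, so p serves as the common divisibility test.
    K⇒E : ∀ n → n × 1# ≡ 0# → n E.× E.1# ≡ E.0#
    K⇒E n n×1 = Characteristic.p∣⇒×≡0 E p p-prime p×1ᴱ
      (decidable-stable (p ∣? n) (Characteristic.×≡0⇒p∣ K p p-prime p×1ᴷ n×1)) E.1#
    go : ∀ {p′} → p ≡ p′ → Homomorphism E K
    go {zero}   p≡ = ⊥-elim (ℕ.≢-nonZero⁻¹ p {{prime⇒nonZero p-prime}} p≡)
    go {suc p′} p≡ = Embedding.homomorphism E K p′ k (proj₂ order-K≥2) fixed
      (subst (λ n → n E.× E.1# ≡ E.0#) p≡ p×1ᴱ) (subst (λ n → n × 1# ≡ 0#) p≡ p×1ᴷ) K⇒E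

  open Homomorphism hom
  open Homomorphisms E K hom

  φ-even : ∀ x → Even (φ x)
  φ-even x = trans (sym (φ-^ x q)) (cong φ (x^q≡x x))

  private
    h-odd = odd-^ (odd 2∤p) m
    h = proj₁ h-odd
    q≡ : q ≡ suc (h ℕ.* 2)
    q≡ = proj₂ h-odd
    order-E≡ : E.order ≡ suc (h ℕ.* 2)
    order-E≡ = trans order-E q≡

  α≢0 : ¬ (α ≡ E.0#)
  α≢0 α≡0 = α-nonsquare (E.0# , trans (E.zeroˡ E.0#) (sym α≡0))

  α^2h≡1 : α E.^ (h ℕ.* 2) ≡ E.1#
  α^2h≡1 = E.x^[order-1] order-E≡ α≢0

  -- The square of α^h is α^(q-1) = 1, and α^h = 1 would make α a square by Euler's criterion in E.
  α^h≡-1 : α E.^ h ≡ E.- E.1#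
  α^h≡-1 = Sum.[ (λ eq → contradiction (E.euler {h} order-E≡ eq) α-nonsquare) , (λ eq → eq) ]′ (E.x*x≡y*y square≡)
    where
    square≡ : (α E.^ h) E.* (α E.^ h) ≡ E.1# E.* E.1#
    square≡ = trans (cong (α E.^ h E.*_) (sym (E.*-identityʳ _))) (trans (sym (E.^-* α h 2)) (trans α^2h≡1 (sym (E.*-identityʳ _))))

  -- With q = 2h + 1, half of |K| - 1 is 2h (h + 1), a multiple of q - 1, so φ(α) raised to it is 1.
  root : IsSquare (φ α)
  root = Polynomials.euler K {(h ℕ.* 2) ℕ.* suc h} order≡ (trans (^-* (φ α) (h ℕ.* 2) (suc h))
    (trans (cong (_^ suc h) (trans (sym (φ-^ α (h ℕ.* 2))) (trans (cong φ α^2h≡1) φ-1))) (1^ (suc h))))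
    where
    open ℕSolver.+-*-Solver renaming (solve to solveℕ; con to conℕ; _:+_ to _+ℕ_; _:*_ to _*ℕ_; _:=_ to _=ℕ_) using ()
    order≡ : order ≡ suc ((h ℕ.* 2) ℕ.* suc h ℕ.* 2)
    order≡ = trans order-K (trans (cong (ℕ._^ 2) q≡) (solveℕ 1 (λ h →
      (conℕ 1 +ℕ h *ℕ conℕ 2) *ℕ ((conℕ 1 +ℕ h *ℕ conℕ 2) *ℕ conℕ 1) =ℕ conℕ 1 +ℕ h *ℕ conℕ 2 *ℕ (conℕ 1 +ℕ h) *ℕ conℕ 2) refl h))

  η = proj₁ root

  -- Since q = 2h + 1, η^q = η (η²)^h = η φ(α^h), and α^h = -1.
  η-odd : Odd η
  η-odd = begin
    η ^ q                              ≡⟨ cong (η ^_) (trans q≡ (cong suc (ℕ.*-comm h 2))) ⟩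
    η * (η ^ (2 ℕ.* h))                ≡⟨ cong (η *_) (^-* η 2 h) ⟩
    η * ((η * (η * 1#)) ^ h)           ≡⟨ cong (λ z → η * ((η * z) ^ h)) (*-identityʳ η) ⟩
    η * ((η * η) ^ h)                  ≡⟨ cong (λ z → η * (z ^ h)) (proj₂ root) ⟩
    η * (φ α ^ h)                      ≡⟨ cong (η *_) (φ-^ α h) ⟨
    η * φ (α E.^ h)                    ≡⟨ cong (λ z → η * φ z) α^h≡-1 ⟩
    η * φ (E.- E.1#)                   ≡⟨ cong (η *_) (trans (φ-neg E.1#) (cong -_ φ-1)) ⟩
    η * - 1#                           ≡⟨ solve 1 (λ x → x :* :- con (pos 1) := :- x) refl η ⟩
    - η                                ∎
    where open ≡-Reasoning

  ω = η ^ (p ℕ.^ (m ℕ.∸ i))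

  ω-odd : Odd ω
  ω-odd = trans (^-comm η (p ℕ.^ (m ℕ.∸ i)) q) (trans (cong (_^ (p ℕ.^ (m ℕ.∸ i))) η-odd)
    (Characteristic.Additivity.f-neg K p p-prime p×1ᴷ (Characteristic.frobenius^-+ K p p-prime p×1ᴷ (m ℕ.∸ i)) η))

  -- The exponents p^(m-i) and p^i multiply to q, and the q-th power fixes φ(α).
  σ[ω*ω]≡φα : σ (ω * ω) ≡ φ α
  σ[ω*ω]≡φα = begin
    σ (ω * ω)                                        ≡⟨ cong σ (^-distrib-* η η (p ℕ.^ (m ℕ.∸ i))) ⟨
    σ ((η * η) ^ (p ℕ.^ (m ℕ.∸ i)))                  ≡⟨ cong (λ z → σ (z ^ (p ℕ.^ (m ℕ.∸ i)))) (proj₂ root) ⟩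
    σ (φ α ^ (p ℕ.^ (m ℕ.∸ i)))                      ≡⟨ ^-* (φ α) (p ℕ.^ (m ℕ.∸ i)) (p ℕ.^ i) ⟨
    φ α ^ (p ℕ.^ (m ℕ.∸ i) ℕ.* p ℕ.^ i)              ≡⟨ cong (φ α ^_) (ℕ.^-distribˡ-+-* p (m ℕ.∸ i) i) ⟨
    φ α ^ (p ℕ.^ (m ℕ.∸ i ℕ.+ i))                    ≡⟨ cong (λ e → φ α ^ (p ℕ.^ e)) (ℕ.m∸n+n≡m (ℕ.<⇒≤ i<m)) ⟩
    φ α ^ q                                          ≡⟨ φ-even α ⟩
    φ α                                              ∎
    where open ≡-Reasoning

  ω≢0 : ¬ (ω ≡ 0#)
  ω≢0 ω≡0 = α≢0 (φ≡0 (trans (sym σ[ω*ω]≡φα) (trans (cong σ (trans (cong (_* ω) ω≡0) (zeroˡ ω))) σ-0)))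

  φω-odd : ∀ x → Odd (φ x * ω)
  φω-odd x = even*odd (φ-even x) ω-odd

  φω≡0 : ∀ {x} → φ x * ω ≡ 0# → x ≡ E.0#
  φω≡0 eq = Sum.[ φ≡0 , (λ ω≡0 → contradiction ω≡0 ω≢0) ]′ (x*y≡0 eq)

  φω-+ : ∀ x y → φ (x E.+ y) * ω ≡ φ x * ω + φ y * ω
  φω-+ x y = trans (cong (_* ω) (φ-+ x y)) (distribʳ ω (φ x) (φ y))

  -- ψ gives K the coordinates belonging to the basis 1, ω over E. Its inverse becomes both M and N
  -- of the isotopism, and the inverse of Λ becomes L.
  ψ Λ : E.Carrier ∧ E.Carrier → Carrier
  ψ (a , b) = φ a + φ b * ω
  Λ (a , b) = pack (φ a) (φ b * ω)

  private
    order-K≡ : order ≡ E.order ℕ.* E.order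
    order-K≡ = trans order-K (trans (cong (q ℕ.*_) (ℕ.*-identityʳ q)) (cong₂ ℕ._*_ (sym order-E) (sym order-E)))

    ψ-+ : ∀ x y → ψ (_⊕_ {E} x y) ≡ ψ x + ψ y
    ψ-+ (a , b) (c , d) = trans (cong₂ _+_ (φ-+ a c) (φω-+ b d))
      (solve 4 (λ a b c d → a :+ c :+ (b :+ d) := a :+ b :+ (c :+ d)) refl (φ a) (φ b * ω) (φ c) (φ d * ω))

    ψ≡0 : ∀ a b → ψ (a , b) ≡ 0# → a ≡ E.0# ∧ b ≡ E.0#
    ψ≡0 a b eq = let φa≡0 , φbω≡0 = even+odd≡0 (φ-even a) (φω-odd b) eq in φ≡0 φa≡0 , φω≡0 φbω≡0

    pack-+ : ∀ a b c d → pack (a + c) (b + d) ≡ pack a b + pack c d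
    pack-+ a b c d = trans (cong (λ z → a + c + (a + c) + (a + c + (a + c)) + (b + d + - z + (b + d + - z))) (σ-+ b d))
      (solve 6 (λ a b c d σb σd →
        a :+ c :+ (a :+ c) :+ (a :+ c :+ (a :+ c)) :+ (b :+ d :+ :- (σb :+ σd) :+ (b :+ d :+ :- (σb :+ σd))) :=
        a :+ a :+ (a :+ a) :+ (b :+ :- σb :+ (b :+ :- σb)) :+ (c :+ c :+ (c :+ c) :+ (d :+ :- σd :+ (d :+ :- σd))))
        refl a b c d (σ b) (σ d))

    Λ-+ : ∀ x y → Λ (_⊕_ {E} x y) ≡ Λ x + Λ y
    Λ-+ (a , b) (c , d) = trans (cong₂ pack (φ-+ a c) (φω-+ b d)) (pack-+ (φ a) (φ b * ω) (φ c) (φ d * ω))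

    Λ≡0 : ∀ a b → Λ (a , b) ≡ 0# → a ≡ E.0# ∧ b ≡ E.0#
    Λ≡0 a b eq = let φa≡0 , φbω≡0 = pack≡0 gcd≡ (φ-even a) (φω-odd b) eq in φ≡0 φa≡0 , φω≡0 φbω≡0

    module ψ = AdditiveInverse E K order-K≡ ψ ψ-+ ψ≡0
    module Λ = AdditiveInverse E K order-K≡ Λ Λ-+ Λ≡0

  star-ψ : ∀ x y → star (ψ x) (ψ y) ≡ Λ (dickson E p i α x y)
  star-ψ (a , b) (c , d) = begin
    star (ψ (a , b)) (ψ (c , d))
      ≡⟨ star≡bilinear (ψ (a , b)) (ψ (c , d)) ⟩
    bilinear (φ a + φ b * ω) (φ c + φ d * ω)
      ≡⟨ bilinear≡pack (φ-even a) (φω-odd b) (φ-even c) (φω-odd d) ⟩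
    pack (φ a * φ c + σ (φ b * ω * (φ d * ω))) (φ a * (φ d * ω) + φ b * ω * φ c)
      ≡⟨ cong₂ pack even-part odd-part ⟩
    Λ (dickson E p i α (a , b) (c , d)) ∎
    where
    open ≡-Reasoning
    even-part : φ a * φ c + σ (φ b * ω * (φ d * ω)) ≡ φ (a E.* c E.+ α E.* ((b E.* d) E.^ (p ℕ.^ i)))
    even-part = begin
      φ a * φ c + σ (φ b * ω * (φ d * ω))
        -- Collecting ω² lets the multiplicativity of σ bring in σ(ω²) = φ(α).
        ≡⟨ cong (λ z → φ a * φ c + σ z) (solve 3 (λ b d w → b :* w :* (d :* w) := w :* w :* (b :* d)) refl (φ b) (φ d) ω) ⟩
      φ a * φ c + σ (ω * ω * (φ b * φ d))
        ≡⟨ cong (φ a * φ c +_) (σ-* (ω * ω) (φ b * φ d)) ⟩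
      φ a * φ c + σ (ω * ω) * σ (φ b * φ d)
        ≡⟨ cong₂ (λ y z → φ a * φ c + y * σ z) σ[ω*ω]≡φα (sym (φ-* b d)) ⟩
      φ a * φ c + φ α * σ (φ (b E.* d))
        ≡⟨ cong (λ z → φ a * φ c + φ α * z) (φ-^ (b E.* d) (p ℕ.^ i)) ⟨
      φ a * φ c + φ α * φ ((b E.* d) E.^ (p ℕ.^ i))
        ≡⟨ cong₂ _+_ (φ-* a c) (φ-* α _) ⟨
      φ (a E.* c) + φ (α E.* ((b E.* d) E.^ (p ℕ.^ i)))
        ≡⟨ φ-+ _ _ ⟨
      φ (a E.* c E.+ α E.* ((b E.* d) E.^ (p ℕ.^ i))) ∎
    odd-part : φ a * (φ d * ω) + φ b * ω * φ c ≡ φ (a E.* d E.+ b E.* c) * ω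
    odd-part = begin
      φ a * (φ d * ω) + φ b * ω * φ c       ≡⟨ solve 5 (λ a b c d w → a :* (d :* w) :+ b :* w :* c := (a :* d :+ b :* c) :* w) refl (φ a) (φ b) (φ c) (φ d) ω ⟩
      (φ a * φ d + φ b * φ c) * ω           ≡⟨ cong (_* ω) (cong₂ _+_ (φ-* a d) (φ-* b c)) ⟨
      (φ (a E.* d) + φ (b E.* c)) * ω       ≡⟨ cong (_* ω) (φ-+ _ _) ⟨
      φ (a E.* d E.+ b E.* c) * ω           ∎

  Λ⁻¹-star : ∀ x y → Λ.f⁻¹ (star x y) ≡ dickson E p i α (ψ.f⁻¹ x) (ψ.f⁻¹ y)
  Λ⁻¹-star x y = Λ.f⁻¹-f (trans (sym (cong₂ star (ψ.f-f⁻¹ x) (ψ.f-f⁻¹ y))) (star-ψ (ψ.f⁻¹ x) (ψ.f⁻¹ y)))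

  isotopic : Isotopic K E star (dickson E p i α)
  isotopic = Λ.f⁻¹ , ψ.f⁻¹ , ψ.f⁻¹ , Λ.f⁻¹-iso , ψ.f⁻¹-iso , ψ.f⁻¹-iso , Λ⁻¹-star

-- The three claims together

open import Data.Nat using (_≤_; _<_; _^_; _*_)
open import Data.Product using (_×_)

theorem4p3 : (p m i : ℕ) → Prime p → ¬ (2 ∣ p) → 2 ≤ m → 0 < i → i < m →
    gcd i m ≡ gcd i (2 * m) →
    (K : FiniteField) → FiniteField.order K ≡ (p ^ m) ^ 2 →
    IsDO p (2 * m) K (polyF p m i K) ×
    Planar K (polyF p m i K) ×
    ((E : FiniteField) → FiniteField.order E ≡ p ^ m →
    (α : FiniteField.Carrier E) → ¬ FiniteField.IsSquare E α →
    Isotopic K E (starF K (polyF p m i K)) (dickson E p i α))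
theorem4p3 p m i p-prime 2∤p _ _ i<m gcd≡ K order-K =
    polyF-isDO p m i K i<m
  , QuadraticExtension.polyF-planar p m i p-prime 2∤p K order-K gcd≡
  , Isotopism.isotopic p m i p-prime 2∤p i<m gcd≡ K order-K
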